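{- Let $p$ be a (sufficiently large) prime, let $N$ be a positive integer with $N<p^{3/5}$, and let $$\mathcal A_N\mathcal A_N=\{m!\,n! \bmod p:\ 1\leqslant m,n\leqslant N\}.$$ Then $|\mathcal A_N\mathcal A_N|\gg N^{1-o(1)}$; that is, for every $\varepsilon>0$ there is a constant $c(\varepsilon)>0$, independent of $p$ and $N$, such that $|\mathcal A_N\mathcal A_N|\geqslant c(\varepsilon)N^{1-\varepsilon}$.
   Context: $|X|$ denotes the cardinality of a set $X$; residues $m!n!$ are taken in $\mathbb F_p$. -}

module Defs where

open import Data.Nat using (ℕ; suc; _*_; _%_; _!; NonZero)
open import Data.Nat.Properties using (_≟_)
open import Data.List using (List; map; concatMap; upTo; length; deduplicate)

range1 : ℕ → List ℕ
range1 N = map suc (upTo N)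

factProdResidues : (p : ℕ) → .{{_ : NonZero p}} → ℕ → List ℕ
factProdResidues p N =
  concatMap (λ m → map (λ n → ((m !) * (n !)) % p) (range1 N)) (range1 N)

cardANAN : (p : ℕ) → .{{_ : NonZero p}} → ℕ → ℕ
cardANAN p N = length (deduplicate _≟_ (factProdResidues p N))

{-# OPTIONS --safe #-}
-- Let A = {n! mod p : n ≤ N}, K = |AA|, and let ℓ be a set of L pairwise coprime numbers up to N.
-- For units y, y′ the congruence y m ≡ y′ m′ has at most r ≪ 1 + N²/p solutions m ≢ m′ in ℓ:
-- the fractions m/m′ of any two solutions are in lowest terms, and agree if they are closer than p/N².
-- Since m! = m (m-1)!, Cauchy–Schwarz turns this into two bounds:
--   * (m , b) ↦ m! b maps ℓ × A to AA, and a collision with m ≢ m′ is determined by m, m′ and the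
--     elements (m-1)! b, (m′-1)! b′ of AA, so (L|A|)² ≤ K (L|A| + K² r);
--   * (m , e) ↦ (m! , (m-1)! e) maps ℓ × A to A × AA, and a collision with m ≢ m′ forces e′ m ≡ e m′,
--     so (L|A|)² ≤ |A|K (L|A| + |A|² r).
-- Unless K ≫ L, the second gives L² ≪ K|A|r and the first L²|A|² ≪ K³r, so L⁶ ≪ K⁵r³ with |A| eliminated;
-- for N⁵ < p³ this is L⁶ ≪ K⁵N. Taking for ℓ the primes up to N and 1, the bound 2^N ≤ 4 N^π(N)
-- makes L at least N up to a logarithm.
module Submission where

open import Defs
open import Data.Empty using (⊥-elim)
open import Data.List using (List; []; _∷_; _++_; map; length; upTo; filter; deduplicate; cartesianProduct)
open import Data.List.Properties using (length-++; length-map; length-upTo; map-++; map-∘)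
open import Data.List.Membership.Propositional using (_∈_; find; lose)
open import Data.List.Membership.Propositional.Properties
open import Data.List.Relation.Unary.All as All using (All; []; _∷_)
open import Data.List.Relation.Unary.AllPairs using (_∷_)
open import Data.List.Relation.Unary.Any using (here; there)
open import Data.List.Relation.Unary.Unique.Propositional using (Unique)
import Data.List.Relation.Unary.Unique.Propositional.Properties as Unique
open import Data.Nat
open import Data.Nat.Combinatorics using (k![n∸k]!∣n!)
open import Data.Nat.Coprimality as Coprime using (Coprime; coprime-divisor; prime⇒coprime; 1-coprimeTo)
open import Data.Nat.DivMod
open import Data.Nat.Divisibility
open import Data.Nat.Induction using (<-rec)
open import Data.Nat.ListAction using (sum)
open import Data.Nat.ListAction.Properties using (sum-++)
open import Data.Nat.Primality using (Prime; euclidsLemma; prime?; prime⇒nonZero; prime⇒nonTrivial; ¬prime[1])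
open import Data.Nat.Primality.Factorisation using (factorise)
open import Data.Nat.Properties
open import Data.List.Relation.Unary.Unique.DecPropositional.Properties _≟_ using (deduplicate-!)
open import Data.Nat.Tactic.RingSolver using (solve-∀)
open import Data.Product using (Σ; ∃; ∃₂; _×_; _,_; proj₁; proj₂)
open import Data.Product.Properties using (≡-dec)
open import Data.Sum using (inj₁; inj₂; [_,_]′)
open import Function using (_∘_)
open import Relation.Binary.Definitions using (DecidableEquality; tri<; tri≈; tri>)
open import Relation.Binary.PropositionalEquality
open import Relation.Nullary using (¬_; Dec; yes; no; contradiction)
open import Relation.Nullary.Decidable using (_×-dec_; ¬?)

-- Finite sums

private
  variable
    A B : Set
    P Q R : Set

-- Cardinalities are written as sums of indicators, so that double counting becomes `∑-swap`.
𝟙 : Dec P → ℕ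
𝟙 (yes _) = 1
𝟙 (no _)  = 0

𝟙-mono : (p : Dec P) (q : Dec Q) → (P → Q) → 𝟙 p ≤ 𝟙 q
𝟙-mono (no _)  _        _ = z≤n
𝟙-mono (yes _) (yes _)  _ = ≤-refl
𝟙-mono (yes p) (no ¬q)  f = ⊥-elim (¬q (f p))

𝟙-true : (p : Dec P) → P → 1 ≤ 𝟙 p
𝟙-true (yes _) _ = ≤-refl
𝟙-true (no ¬p) p = ⊥-elim (¬p p)

𝟙-false : (p : Dec P) → ¬ P → 𝟙 p ≤ 0
𝟙-false (yes p) ¬p = ⊥-elim (¬p p)
𝟙-false (no _)  _  = z≤n

∑ : List A → (A → ℕ) → ℕ
∑ xs f = sum (map f xs)

∑-mono : ∀ (xs : List A) {f g : A → ℕ} → (∀ {x} → x ∈ xs → f x ≤ g x) → ∑ xs f ≤ ∑ xs g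
∑-mono []       _ = z≤n
∑-mono (x ∷ xs) h = +-mono-≤ (h (here refl)) (∑-mono xs (h ∘ there))

∑-cong : ∀ (xs : List A) {f g : A → ℕ} → (∀ x → f x ≡ g x) → ∑ xs f ≡ ∑ xs g
∑-cong []       _ = refl
∑-cong (x ∷ xs) h = cong₂ _+_ (h x) (∑-cong xs h)

∑-const : ∀ (xs : List A) c → ∑ xs (λ _ → c) ≡ length xs * c
∑-const []       c = refl
∑-const (x ∷ xs) c = cong (c +_) (∑-const xs c)

∑-+ : ∀ (xs : List A) (f g : A → ℕ) → ∑ xs (λ x → f x + g x) ≡ ∑ xs f + ∑ xs g
∑-+ []       f g = refl
∑-+ (x ∷ xs) f g rewrite ∑-+ xs f g = interchange (f x) (g x) (∑ xs f) (∑ xs g)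
  where
  interchange : ∀ a b c d → a + b + (c + d) ≡ a + c + (b + d)
  interchange = solve-∀

∑-*ˡ : ∀ (xs : List A) c (f : A → ℕ) → ∑ xs (λ x → c * f x) ≡ c * ∑ xs f
∑-*ˡ []       c f = sym (*-zeroʳ c)
∑-*ˡ (x ∷ xs) c f rewrite ∑-*ˡ xs c f = sym (*-distribˡ-+ c (f x) (∑ xs f))

∑-*ʳ : ∀ (xs : List A) c (f : A → ℕ) → ∑ xs (λ x → f x * c) ≡ ∑ xs f * c
∑-*ʳ []       c f = refl
∑-*ʳ (x ∷ xs) c f rewrite ∑-*ʳ xs c f = sym (*-distribʳ-+ c (f x) (∑ xs f))

∑-swap : ∀ (xs : List A) (ys : List B) (f : A → B → ℕ) →
         ∑ xs (λ x → ∑ ys (f x)) ≡ ∑ ys (λ y → ∑ xs (λ x → f x y))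
∑-swap []       ys f = sym (trans (∑-const ys 0) (*-zeroʳ (length ys)))
∑-swap (x ∷ xs) ys f rewrite ∑-swap xs ys f = sym (∑-+ ys (f x) _)

∑-cartesianProduct : ∀ (xs : List A) (ys : List B) (f : A × B → ℕ) →
                     ∑ (cartesianProduct xs ys) f ≡ ∑ xs (λ x → ∑ ys (λ y → f (x , y)))
∑-cartesianProduct []       ys f = refl
∑-cartesianProduct (x ∷ xs) ys f = begin
  sum (map f (map (x ,_) ys ++ cartesianProduct xs ys))
    ≡⟨ cong sum (map-++ f (map (x ,_) ys) _) ⟩
  sum (map f (map (x ,_) ys) ++ map f (cartesianProduct xs ys))
    ≡⟨ sum-++ (map f (map (x ,_) ys)) _ ⟩
  sum (map f (map (x ,_) ys)) + ∑ (cartesianProduct xs ys) f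
    ≡⟨ cong₂ _+_ (cong sum (sym (map-∘ ys))) (∑-cartesianProduct xs ys f) ⟩
  ∑ ys (λ y → f (x , y)) + ∑ xs (λ x′ → ∑ ys (λ y → f (x′ , y)))
    ∎
  where open ≡-Reasoning

length-cartesianProduct : ∀ (xs : List A) (ys : List B) →
                          length (cartesianProduct xs ys) ≡ length xs * length ys
length-cartesianProduct []       ys = refl
length-cartesianProduct (x ∷ xs) ys = trans (length-++ (map (x ,_) ys))
  (cong₂ _+_ (length-map (x ,_) ys) (length-cartesianProduct xs ys))

term≤∑ : ∀ {xs : List A} (f : A → ℕ) {x} → x ∈ xs → f x ≤ ∑ xs f
term≤∑ f (here refl)         = m≤m+n _ _
term≤∑ f (there {x = y} x∈xs) = ≤-trans (term≤∑ f x∈xs) (m≤n+m _ (f y))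

∑𝟙≤1 : ∀ {xs : List A} {S : A → Set} (S? : ∀ x → Dec (S x)) → Unique xs →
       (∀ {x y} → x ∈ xs → y ∈ xs → S x → S y → x ≡ y) → ∑ xs (𝟙 ∘ S?) ≤ 1
∑𝟙≤1 {xs = []} S? _ _ = z≤n
∑𝟙≤1 {xs = x ∷ xs} S? (x≢ ∷ uxs) h with S? x
... | no _   = ∑𝟙≤1 S? uxs (λ i j → h (there i) (there j))
... | yes Sx = s≤s (≤-trans (∑-mono xs none) (≤-reflexive (trans (∑-const xs 0) (*-zeroʳ (length xs)))))
  where
  none : ∀ {y} → y ∈ xs → 𝟙 (S? y) ≤ 0
  none y∈ = 𝟙-false (S? _) (λ Sy → All.lookup x≢ y∈ (h (here refl) (there y∈) Sx Sy))

-- Pigeonhole by double counting: each `x` with `S x` is charged to its key below `b`, and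
-- injectivity leaves at most one charge per key.
∑𝟙≤keys : ∀ {xs : List A} {S : A → Set} (S? : ∀ x → Dec (S x)) (key : A → ℕ) {b} → Unique xs →
          (∀ {x} → x ∈ xs → S x → key x < b) →
          (∀ {x y} → x ∈ xs → y ∈ xs → S x → S y → key x ≡ key y → x ≡ y) →
          ∑ xs (𝟙 ∘ S?) ≤ b
∑𝟙≤keys {xs = xs} S? key {b} uxs key< inj = begin
  ∑ xs (𝟙 ∘ S?)                                            ≤⟨ ∑-mono xs spread ⟩
  ∑ xs (λ x → ∑ (upTo b) (λ k → 𝟙 (S? x ×-dec (key x ≟ k))))  ≡⟨ ∑-swap xs (upTo b) _ ⟩
  ∑ (upTo b) (λ k → ∑ xs (λ x → 𝟙 (S? x ×-dec (key x ≟ k))))  ≤⟨ ∑-mono (upTo b) (λ {k} _ →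
    ∑𝟙≤1 (λ x → S? x ×-dec (key x ≟ k)) uxs
      λ { i j (Sx , p) (Sy , q) → inj i j Sx Sy (trans p (sym q)) }) ⟩
  ∑ (upTo b) (λ _ → 1)                                     ≡⟨ ∑-const (upTo b) 1 ⟩
  length (upTo b) * 1                                      ≡⟨ *-identityʳ _ ⟩
  length (upTo b)                                          ≡⟨ length-upTo b ⟩
  b                                                        ∎
  where
  open ≤-Reasoning
  spread : ∀ {x} → x ∈ xs → 𝟙 (S? x) ≤ ∑ (upTo b) (λ k → 𝟙 (S? x ×-dec (key x ≟ k)))
  spread {x} x∈ with S? x
  ... | no _   = z≤n
  ... | yes Sx = ≤-trans (𝟙-true (yes Sx ×-dec (key x ≟ key x)) (Sx , refl))
                   (term≤∑ (λ k → 𝟙 (yes Sx ×-dec (key x ≟ k))) (∈-upTo⁺ (key< x∈ Sx)))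

-- Each `f (g x)` is charged to the entry `g x` of `ys`; injectivity of `g` charges no entry twice.
∑-injection : ∀ (_≟ᴮ_ : DecidableEquality B) {xs : List A} {ys : List B} (g : A → B) (f : B → ℕ) →
              Unique xs → (∀ {x} → x ∈ xs → g x ∈ ys) →
              (∀ {x x′} → x ∈ xs → x′ ∈ xs → g x ≡ g x′ → x ≡ x′) →
              ∑ xs (f ∘ g) ≤ ∑ ys f
∑-injection _≟ᴮ_ {xs} {ys} g f uxs g∈ inj = begin
  ∑ xs (f ∘ g)                                   ≤⟨ ∑-mono xs spread ⟩
  ∑ xs (λ x → ∑ ys (λ y → f y * 𝟙 (g x ≟ᴮ y)))    ≡⟨ ∑-swap xs ys _ ⟩
  ∑ ys (λ y → ∑ xs (λ x → f y * 𝟙 (g x ≟ᴮ y)))    ≤⟨ ∑-mono ys (λ {y} _ → collect y) ⟩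
  ∑ ys f                                         ∎
  where
  open ≤-Reasoning
  spread : ∀ {x} → x ∈ xs → f (g x) ≤ ∑ ys (λ y → f y * 𝟙 (g x ≟ᴮ y))
  spread {x} x∈ = begin
    f (g x)                            ≡⟨ *-identityʳ _ ⟨
    f (g x) * 1                        ≤⟨ *-monoʳ-≤ (f (g x)) (𝟙-true (g x ≟ᴮ g x) refl) ⟩
    f (g x) * 𝟙 (g x ≟ᴮ g x)            ≤⟨ term≤∑ (λ y → f y * 𝟙 (g x ≟ᴮ y)) (g∈ x∈) ⟩
    ∑ ys (λ y → f y * 𝟙 (g x ≟ᴮ y))     ∎
  collect : ∀ y → ∑ xs (λ x → f y * 𝟙 (g x ≟ᴮ y)) ≤ f y
  collect y = begin
    ∑ xs (λ x → f y * 𝟙 (g x ≟ᴮ y))   ≡⟨ ∑-*ˡ xs (f y) _ ⟩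
    f y * ∑ xs (λ x → 𝟙 (g x ≟ᴮ y))   ≤⟨ *-monoʳ-≤ (f y) (∑𝟙≤1 (λ x → g x ≟ᴮ y) uxs
                                          (λ i j p q → inj i j (trans p (sym q)))) ⟩
    f y * 1                          ≡⟨ *-identityʳ _ ⟩
    f y                              ∎

-- Cauchy-Schwarz in the natural numbers

2mn≤m²+n² : ∀ m n → 2 * (m * n) ≤ m * m + n * n
2mn≤m²+n² zero    n       = z≤n
2mn≤m²+n² (suc m) zero    rewrite *-zeroʳ m = z≤n
2mn≤m²+n² (suc m) (suc n) = begin
  2 * (suc m * suc n)                    ≡⟨ left m n ⟩
  2 * (m * n) + 2 * (m + n + 1)          ≤⟨ +-monoˡ-≤ _ (2mn≤m²+n² m n) ⟩
  m * m + n * n + 2 * (m + n + 1)        ≡⟨ right m n ⟩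
  suc m * suc m + suc n * suc n          ∎
  where
  open ≤-Reasoning
  left : ∀ m n → 2 * (suc m * suc n) ≡ 2 * (m * n) + 2 * (m + n + 1)
  left = solve-∀
  right : ∀ m n → m * m + n * n + 2 * (m + n + 1) ≡ suc m * suc m + suc n * suc n
  right = solve-∀

-- Induction on the list: in the expanded square each cross term 2ab is at most a² + b², and summed
-- over the tail these supply what the larger factor `suc n` allows.
∑-square : ∀ (xs : List A) (f : A → ℕ) → ∑ xs f * ∑ xs f ≤ length xs * ∑ xs (λ x → f x * f x)
∑-square []       f = z≤n
∑-square (x ∷ xs) f = begin
  (a + s) * (a + s)                        ≡⟨ expand a s ⟩
  a * a + 2 * (a * s) + s * s              ≤⟨ +-mono-≤ (+-monoʳ-≤ (a * a) cross) (∑-square xs f) ⟩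
  a * a + (n * (a * a) + q) + n * q        ≡⟨ contract n a q ⟩
  suc n * (a * a + q)                      ∎
  where
  open ≤-Reasoning
  a = f x
  s = ∑ xs f
  n = length xs
  q = ∑ xs (λ y → f y * f y)
  expand : ∀ a s → (a + s) * (a + s) ≡ a * a + 2 * (a * s) + s * s
  expand = solve-∀
  contract : ∀ n a q → a * a + (n * (a * a) + q) + n * q ≡ suc n * (a * a + q)
  contract = solve-∀
  cross : 2 * (a * s) ≤ n * (a * a) + q
  cross = begin
    2 * (a * s)                            ≡⟨ cong (2 *_) (∑-*ˡ xs a f) ⟨
    2 * ∑ xs (λ y → a * f y)               ≡⟨ ∑-*ˡ xs 2 _ ⟨
    ∑ xs (λ y → 2 * (a * f y))             ≤⟨ ∑-mono xs (λ {y} _ → 2mn≤m²+n² a (f y)) ⟩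
    ∑ xs (λ y → a * a + f y * f y)         ≡⟨ ∑-+ xs (λ _ → a * a) _ ⟩
    ∑ xs (λ _ → a * a) + q                 ≡⟨ cong (_+ q) (∑-const xs (a * a)) ⟩
    n * (a * a) + q                        ∎

-- Cauchy–Schwarz over the fibres of f.
length²≤values*collisions : ∀ (_≟ᴮ_ : DecidableEquality B) (xs : List A) {vs : List B} (f : A → B) →
  Unique vs → (∀ {x} → x ∈ xs → f x ∈ vs) →
  length xs * length xs ≤ length vs * ∑ xs (λ x → ∑ xs (λ y → 𝟙 (f x ≟ᴮ f y)))
length²≤values*collisions _≟ᴮ_ xs {vs} f uvs f∈ = begin
  length xs * length xs                      ≤⟨ *-mono-≤ covered covered ⟩
  ∑ vs c * ∑ vs c                            ≤⟨ ∑-square vs c ⟩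
  length vs * ∑ vs (λ v → c v * c v)         ≤⟨ *-monoʳ-≤ (length vs) squares ⟩
  length vs * ∑ xs (λ x → ∑ xs (λ y → 𝟙 (f x ≟ᴮ f y)))  ∎
  where
  open ≤-Reasoning
  -- `c v` is the size of the fibre of `f` over `v`.
  c : _ → ℕ
  c v = ∑ xs (λ x → 𝟙 (f x ≟ᴮ v))
  covered : length xs ≤ ∑ vs c
  covered = begin
    length xs                                    ≡⟨ *-identityʳ _ ⟨
    length xs * 1                                ≡⟨ ∑-const xs 1 ⟨
    ∑ xs (λ _ → 1)                               ≤⟨ ∑-mono xs (λ {x} x∈ → ≤-trans (𝟙-true (f x ≟ᴮ f x) refl)
                                                      (term≤∑ (λ v → 𝟙 (f x ≟ᴮ v)) (f∈ x∈))) ⟩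
    ∑ xs (λ x → ∑ vs (λ v → 𝟙 (f x ≟ᴮ v)))        ≡⟨ ∑-swap xs vs _ ⟩
    ∑ vs c                                       ∎
  -- In the duplicate-free `vs` at most one `v` equals both `f x` and `f y`, and only if these
  -- agree.
  at-one-value : ∀ x y → ∑ vs (λ v → 𝟙 (f x ≟ᴮ v) * 𝟙 (f y ≟ᴮ v)) ≤ 𝟙 (f x ≟ᴮ f y)
  at-one-value x y = begin
    ∑ vs (λ v → 𝟙 (f x ≟ᴮ v) * 𝟙 (f y ≟ᴮ v))       ≤⟨ ∑-mono vs (λ {v} _ → merge (f x ≟ᴮ v) (f y ≟ᴮ v) (f x ≟ᴮ f y)
                                                       (λ p q → trans p (sym q))) ⟩
    ∑ vs (λ v → 𝟙 (f x ≟ᴮ f y) * 𝟙 (f x ≟ᴮ v))     ≡⟨ ∑-*ˡ vs (𝟙 (f x ≟ᴮ f y)) _ ⟩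
    𝟙 (f x ≟ᴮ f y) * ∑ vs (λ v → 𝟙 (f x ≟ᴮ v))     ≤⟨ *-monoʳ-≤ (𝟙 (f x ≟ᴮ f y)) (∑𝟙≤1 (λ v → f x ≟ᴮ v) uvs
                                                       (λ _ _ p q → trans (sym p) q)) ⟩
    𝟙 (f x ≟ᴮ f y) * 1                            ≡⟨ *-identityʳ _ ⟩
    𝟙 (f x ≟ᴮ f y)                                ∎
    where
    merge : (p : Dec P) (q : Dec Q) (r : Dec R) → (P → Q → R) → 𝟙 p * 𝟙 q ≤ 𝟙 r * 𝟙 p
    merge (no _)  _       _       _ = z≤n
    merge (yes _) (no _)  _       _ = z≤n
    merge (yes _) (yes _) (yes _) _ = ≤-refl
    merge (yes p) (yes q) (no ¬r) h = ⊥-elim (¬r (h p q))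
  squares : ∑ vs (λ v → c v * c v) ≤ ∑ xs (λ x → ∑ xs (λ y → 𝟙 (f x ≟ᴮ f y)))
  squares = begin
    ∑ vs (λ v → c v * c v)
      ≡⟨ ∑-cong vs (λ v → trans (sym (∑-*ʳ xs (c v) _)) (∑-cong xs (λ x → sym (∑-*ˡ xs (𝟙 (f x ≟ᴮ v)) _)))) ⟩
    ∑ vs (λ v → ∑ xs (λ x → ∑ xs (λ y → 𝟙 (f x ≟ᴮ v) * 𝟙 (f y ≟ᴮ v))))
      ≡⟨ ∑-swap vs xs _ ⟩
    ∑ xs (λ x → ∑ vs (λ v → ∑ xs (λ y → 𝟙 (f x ≟ᴮ v) * 𝟙 (f y ≟ᴮ v))))
      ≡⟨ ∑-cong xs (λ x → ∑-swap vs xs _) ⟩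
    ∑ xs (λ x → ∑ xs (λ y → ∑ vs (λ v → 𝟙 (f x ≟ᴮ v) * 𝟙 (f y ≟ᴮ v))))
      ≤⟨ ∑-mono xs (λ {x} _ → ∑-mono xs (λ {y} _ → at-one-value x y)) ⟩
    ∑ xs (λ x → ∑ xs (λ y → 𝟙 (f x ≟ᴮ f y)))
      ∎

-- Congruences modulo p

module _ {p : ℕ} .{{_ : NonZero p}} where

  -- The distance replaces a - b: equal remainders cancel in it and leave a multiple of `p`.
  %≡⇒∣ : ∀ a b → a % p ≡ b % p → p ∣ ∣ a - b ∣
  %≡⇒∣ a b eq = subst (p ∣_) (sym distance) (n∣m*n ∣ a / p - b / p ∣)
    where
    open ≡-Reasoning
    distance : ∣ a - b ∣ ≡ ∣ a / p - b / p ∣ * p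
    distance = begin
      ∣ a - b ∣                                          ≡⟨ cong₂ ∣_-_∣ (m≡m%n+[m/n]*n a p) (m≡m%n+[m/n]*n b p) ⟩
      ∣ a % p + a / p * p - b % p + b / p * p ∣          ≡⟨ cong (λ r → ∣ r + a / p * p - b % p + b / p * p ∣) eq ⟩
      ∣ b % p + a / p * p - b % p + b / p * p ∣          ≡⟨ ∣m+n-m+o∣≡∣n-o∣ (b % p) _ _ ⟩
      ∣ a / p * p - b / p * p ∣                          ≡⟨ *-distribʳ-∣-∣ p (a / p) (b / p) ⟨
      ∣ a / p - b / p ∣ * p                              ∎

  ∣⇒%≡ : ∀ a b → p ∣ ∣ a - b ∣ → a % p ≡ b % p
  ∣⇒%≡ a b d with ≤-total a b
  ... | inj₁ a≤b = sym (trans (cong (_% p) (sym (trans (cong (a +_) (m≤n⇒∣m-n∣≡n∸m a≤b)) (m+[n∸m]≡n a≤b))))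
                              (%-remove-+ʳ a d))
  ... | inj₂ b≤a = trans (cong (_% p) (sym (trans (cong (b +_) (m≤n⇒∣n-m∣≡n∸m b≤a)) (m+[n∸m]≡n b≤a))))
                         (%-remove-+ʳ b d)

  *-cong-% : ∀ a b {a′ b′} → a % p ≡ a′ % p → b % p ≡ b′ % p → (a * b) % p ≡ (a′ * b′) % p
  *-cong-% a b {a′} {b′} eq eq′ = begin
    (a * b) % p                  ≡⟨ %-distribˡ-* a b p ⟩
    ((a % p) * (b % p)) % p      ≡⟨ cong₂ (λ s t → (s * t) % p) eq eq′ ⟩
    ((a′ % p) * (b′ % p)) % p    ≡⟨ %-distribˡ-* a′ b′ p ⟨
    (a′ * b′) % p                ∎
    where open ≡-Reasoning

  *-cancelˡ-% : Prime p → ∀ c a b → ¬ p ∣ c → (c * a) % p ≡ (c * b) % p → a % p ≡ b % p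
  *-cancelˡ-% pr c a b p∤c eq =
    ∣⇒%≡ a b ([ (λ p∣c → contradiction p∣c p∤c) , (λ d → d) ]′
      (euclidsLemma c ∣ a - b ∣ pr (subst (p ∣_) (sym (*-distribˡ-∣-∣ c a b)) (%≡⇒∣ (c * a) (c * b) eq))))

  -- Both m/m′ and n/n′ represent the residue y′/y: one congruence is multiplied by the reverse of
  -- the other, and the unit `y * y′` is cancelled.
  cross-% : Prime p → ∀ y y′ {m m′ n n′} → ¬ p ∣ y → ¬ p ∣ y′ →
            (y * m) % p ≡ (y′ * m′) % p → (y * n) % p ≡ (y′ * n′) % p → (m * n′) % p ≡ (m′ * n) % p
  cross-% pr y y′ {m} {m′} {n} {n′} p∤y p∤y′ eq eq′ =
    *-cancelˡ-% pr (y * y′) (m * n′) (m′ * n) ([ p∤y , p∤y′ ]′ ∘ euclidsLemma y y′ pr) (begin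
      ((y * y′) * (m * n′)) % p  ≡⟨ cong (_% p) (left y y′ m n′) ⟩
      ((y * m) * (y′ * n′)) % p  ≡⟨ *-cong-% (y * m) (y′ * n′) eq (sym eq′) ⟩
      ((y′ * m′) * (y * n)) % p  ≡⟨ cong (_% p) (right y y′ m′ n) ⟩
      ((y * y′) * (m′ * n)) % p  ∎)
    where
    open ≡-Reasoning
    left : ∀ a b c d → (a * b) * (c * d) ≡ (a * c) * (b * d)
    left = solve-∀
    right : ∀ a b c d → (b * c) * (a * d) ≡ (a * b) * (c * d)
    right = solve-∀

  -- The diagonal is excluded because for equal `y` and `y′` it consists entirely of solutions; it
  -- is counted separately in `collisions-bound`.
  Parallel : ℕ → ℕ → ℕ → ℕ → Set
  Parallel y y′ m m′ = m ≢ m′ × (y * m) % p ≡ (y′ * m′) % p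

  parallel? : ∀ y y′ m m′ → Dec (Parallel y y′ m m′)
  parallel? y y′ m m′ = ¬? (m ≟ m′) ×-dec ((y * m) % p ≟ (y′ * m′) % p)

-- Junk value: a ÷ 0 = 0.
_÷_ : ℕ → ℕ → ℕ
a ÷ zero  = 0
a ÷ suc b = a / suc b

÷-lower : ∀ a b → (a ÷ b) * b ≤ a
÷-lower a zero    = z≤n
÷-lower a (suc b) = m/n*n≤m a (suc b)

÷-upper : ∀ a b → 1 ≤ b → a < suc (a ÷ b) * b
÷-upper a (suc b) _ = begin-strict
  a                                          ≡⟨ m≡m%n+[m/n]*n a (suc b) ⟩
  a % suc b + (a / suc b) * suc b            <⟨ +-monoˡ-< _ (m%n<n a (suc b)) ⟩
  suc b + (a / suc b) * suc b                ∎
  where open ≤-Reasoning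

÷-< : ∀ {a b c} → 1 ≤ b → a < c * b → a ÷ b < c
÷-< {b = suc b} _ a< = m<n*o⇒m/o<n a<

-- If ⌊m′B/m⌋ = ⌊n′B/n⌋ then the fractions m′/m and n′/n differ by less than 1/B.
cross-< : ∀ {N p} B m m′ n n′ → 1 ≤ m → 1 ≤ n → m ≤ N → n ≤ N → N * N ≤ B * p →
          (m′ * B) ÷ m ≡ (n′ * B) ÷ n → m′ * n < n′ * m + p
cross-< {N} {p} B m m′ n n′ 1≤m 1≤n m≤N n≤N N²≤Bp eq = *-cancelˡ-< B _ _ (begin-strict
  B * (m′ * n)                   ≡⟨ rearrange₁ B m′ n ⟩
  m′ * B * n                     <⟨ *-monoˡ-< n {{>-nonZero 1≤n}} (÷-upper (m′ * B) m 1≤m) ⟩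
  suc c * m * n                  ≡⟨ rearrange₂ c m n ⟩
  c * n * m + m * n              ≡⟨ cong (λ d → d * n * m + m * n) eq ⟩
  d * n * m + m * n              ≤⟨ +-mono-≤ (*-monoˡ-≤ m (÷-lower (n′ * B) n)) (≤-trans (*-mono-≤ m≤N n≤N) N²≤Bp) ⟩
  n′ * B * m + B * p             ≡⟨ rearrange₃ B n′ m p ⟩
  B * (n′ * m + p)               ∎)
  where
  open ≤-Reasoning
  c = (m′ * B) ÷ m
  d = (n′ * B) ÷ n
  rearrange₁ : ∀ B m′ n → B * (m′ * n) ≡ m′ * B * n
  rearrange₁ = solve-∀
  rearrange₂ : ∀ c m n → suc c * m * n ≡ c * n * m + m * n
  rearrange₂ = solve-∀
  rearrange₃ : ∀ B n′ m p → n′ * B * m + B * p ≡ B * (n′ * m + p)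
  rearrange₃ = solve-∀

∣-∣-< : ∀ {a b c} → a < b + c → b < a + c → ∣ a - b ∣ < c
∣-∣-< {a} {b} {c} a<b+c b<a+c with ≤-total a b
... | inj₁ a≤b rewrite m≤n⇒∣m-n∣≡n∸m a≤b = +-cancelˡ-< a _ _ (subst (_< a + c) (sym (m+[n∸m]≡n a≤b)) b<a+c)
... | inj₂ b≤a rewrite m≤n⇒∣n-m∣≡n∸m b≤a = +-cancelˡ-< b _ _ (subst (_< b + c) (sym (m+[n∸m]≡n b≤a)) a<b+c)

∣∧<⇒≡0 : ∀ {d n} → d ∣ n → n < d → n ≡ 0
∣∧<⇒≡0 {n = zero}  _   _   = refl
∣∧<⇒≡0 {n = suc n} d∣n n<d = contradiction (∣⇒≤ d∣n) (<⇒≱ n<d)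

-- Coprimality turns `m ∣ m′ * n` into `m ∣ n`, and symmetrically `n ∣ m`; then `m` cancels.
lowest-terms-unique : ∀ {m m′ n n′} → 1 ≤ m → Coprime m m′ → Coprime n n′ →
                      m * n′ ≡ m′ * n → m ≡ n × m′ ≡ n′
lowest-terms-unique {m} {m′} {n} {n′} 1≤m cop cop′ eq = m≡n , m′≡n′
  where
  m∣n : m ∣ n
  m∣n = coprime-divisor cop (subst (m ∣_) eq (m∣m*n n′))
  n∣m : n ∣ m
  n∣m = coprime-divisor cop′ (subst (n ∣_) (trans (sym eq) (*-comm m n′)) (n∣m*n m′))
  m≡n : m ≡ n
  m≡n = ∣-antisym m∣n n∣m
  m′≡n′ : m′ ≡ n′
  m′≡n′ = *-cancelʳ-≡ m′ n′ m {{>-nonZero 1≤m}} (trans (cong (m′ *_) m≡n) (trans (sym eq) (*-comm m n′)))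

-- Solutions of a linear congruence in a pairwise coprime set

record PairwiseCoprimeUpTo (N : ℕ) (ls : List ℕ) : Set where
  field
    unique  : Unique ls
    1≤_     : ∀ {m} → m ∈ ls → 1 ≤ m
    ≤N_     : ∀ {m} → m ∈ ls → m ≤ N
    -- This puts every fraction of two distinct entries in lowest terms.
    coprime : ∀ {m n} → m ∈ ls → n ∈ ls → m ≢ n → Coprime m n

module _ {p N B : ℕ} .{{_ : NonZero p}} (pr : Prime p) (N²≤Bp : N * N ≤ B * p)
         {ls : List ℕ} (cop : PairwiseCoprimeUpTo N ls) where
  open PairwiseCoprimeUpTo cop

  private
    -- The condition `m′ < m` makes m′/m less than 1, which keeps `key` below `B`.
    Descending : ℕ → ℕ → ℕ × ℕ → Set
    Descending y y′ (m , m′) = m′ < m × (y * m) % p ≡ (y′ * m′) % p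

    descending? : ∀ y y′ m,m′ → Dec (Descending y y′ m,m′)
    descending? y y′ (m , m′) = (m′ <? m) ×-dec ((y * m) % p ≟ (y′ * m′) % p)

    -- The index of the interval of length 1/B that contains m′/m.
    key : ℕ × ℕ → ℕ
    key (m , m′) = (m′ * B) ÷ m

  -- Two solutions with the same key give fractions m/m′ and n/n′ whose cross-multiplication
  -- holds modulo p and, the two sides being less than p apart, in ℕ; coprimality concludes.
  count-descending : ∀ y y′ → ¬ p ∣ y → ¬ p ∣ y′ →
    ∑ ls (λ m → ∑ ls (λ m′ → 𝟙 (descending? y y′ (m , m′)))) ≤ B
  count-descending y y′ p∤y p∤y′ = begin
    ∑ ls (λ m → ∑ ls (λ m′ → 𝟙 (descending? y y′ (m , m′))))
      ≡⟨ ∑-cartesianProduct ls ls _ ⟨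
    ∑ (cartesianProduct ls ls) (𝟙 ∘ descending? y y′)
      ≤⟨ ∑𝟙≤keys (descending? y y′) key (Unique.cartesianProduct⁺ unique unique) key< key-injective ⟩
    B ∎
    where
    open ≤-Reasoning
    key< : ∀ {x} → x ∈ cartesianProduct ls ls → Descending y y′ x → key x < B
    key< {m , m′} x∈ (m′<m , _) = ÷-< {m′ * B} 1≤m (begin-strict
      m′ * B  <⟨ *-monoˡ-< B {{>-nonZero 0<B}} m′<m ⟩
      m * B   ≡⟨ *-comm m B ⟩
      B * m   ∎)
      where
      m∈ = proj₁ (∈-cartesianProduct⁻ ls ls x∈)
      1≤m = 1≤ m∈
      1≤N = ≤-trans 1≤m (≤N m∈)
      0<B : 0 < B
      -- If `B` were 0, the bound `N * N ≤ B * p` would contradict `1 ≤ N`.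
      0<B = n≢0⇒n>0 λ { refl → contradiction (≤-trans (*-mono-≤ 1≤N 1≤N) N²≤Bp) λ () }
    key-injective : ∀ {x z} → x ∈ cartesianProduct ls ls → z ∈ cartesianProduct ls ls →
                    Descending y y′ x → Descending y y′ z → key x ≡ key z → x ≡ z
    key-injective {m , m′} {n , n′} x∈ z∈ (m′<m , eqm) (n′<n , eqn) keys = cong₂ _,_ (proj₁ same) (proj₂ same)
      where
      m∈  = proj₁ (∈-cartesianProduct⁻ ls ls x∈)
      m′∈ = proj₂ (∈-cartesianProduct⁻ ls ls x∈)
      n∈  = proj₁ (∈-cartesianProduct⁻ ls ls z∈)
      n′∈ = proj₂ (∈-cartesianProduct⁻ ls ls z∈)
      close : ∣ m * n′ - m′ * n ∣ < p
      close = ∣-∣-<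
        (subst (_< m′ * n + p) (*-comm n′ m) (cross-< B n n′ m m′ (1≤ n∈) (1≤ m∈) (≤N n∈) (≤N m∈) N²≤Bp (sym keys)))
        (subst (λ k → m′ * n < k + p) (*-comm n′ m) (cross-< B m m′ n n′ (1≤ m∈) (1≤ n∈) (≤N m∈) (≤N n∈) N²≤Bp keys))
      same : m ≡ n × m′ ≡ n′
      same = lowest-terms-unique (1≤ m∈) (coprime m∈ m′∈ (≢-sym (<⇒≢ m′<m))) (coprime n∈ n′∈ (≢-sym (<⇒≢ n′<n)))
        (∣m-n∣≡0⇒m≡n (∣∧<⇒≡0 (%≡⇒∣ (m * n′) (m′ * n) (cross-% pr y y′ p∤y p∤y′ eqm eqn)) close))

  -- The factor 2 comes from the two possible orders of `m` and `m′`: a solution with `m < m′`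
  -- descends once `y` and `y′` are interchanged.
  count-parallel : ∀ y y′ → ¬ p ∣ y → ¬ p ∣ y′ →
    ∑ ls (λ m → ∑ ls (λ m′ → 𝟙 (parallel? y y′ m m′))) ≤ 2 * B
  count-parallel y y′ p∤y p∤y′ = begin
    ∑ ls (λ m → ∑ ls (λ m′ → 𝟙 (parallel? y y′ m m′)))
      ≤⟨ ∑-mono ls (λ {m} _ → ∑-mono ls (λ {m′} _ → split m m′)) ⟩
    ∑ ls (λ m → ∑ ls (λ m′ → down m m′ + up m m′))
      ≡⟨ ∑-cong ls (λ m → ∑-+ ls (down m) (up m)) ⟩
    ∑ ls (λ m → ∑ ls (down m) + ∑ ls (up m))
      ≡⟨ ∑-+ ls _ _ ⟩
    ∑ ls (λ m → ∑ ls (down m)) + ∑ ls (λ m → ∑ ls (up m))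
      ≡⟨ cong (∑ ls (λ m → ∑ ls (down m)) +_) (∑-swap ls ls up) ⟩
    ∑ ls (λ m → ∑ ls (down m)) + ∑ ls (λ m′ → ∑ ls (λ m → up m m′))
      ≤⟨ +-mono-≤ (count-descending y y′ p∤y p∤y′) (count-descending y′ y p∤y′ p∤y) ⟩
    B + B
      ≡⟨ cong (B +_) (+-identityʳ B) ⟨
    2 * B ∎
    where
    open ≤-Reasoning
    down up : ℕ → ℕ → ℕ
    down m m′ = 𝟙 (descending? y y′ (m , m′))
    up   m m′ = 𝟙 (descending? y′ y (m′ , m))
    split : ∀ m m′ → 𝟙 (parallel? y y′ m m′) ≤ down m m′ + up m m′
    split m m′ with <-cmp m m′
    ... | tri< m<m′ _ _ = ≤-trans (𝟙-mono (parallel? y y′ m m′) (descending? y′ y (m′ , m))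
                                    (λ (_ , eq) → m<m′ , sym eq)) (m≤n+m _ (down m m′))
    ... | tri≈ _ m≡m′ _ = ≤-trans (𝟙-false (parallel? y y′ m m′) (λ (m≢m′ , _) → m≢m′ m≡m′)) z≤n
    ... | tri> _ _ m′<m = ≤-trans (𝟙-mono (parallel? y y′ m m′) (descending? y y′ (m , m′))
                                    (λ (_ , eq) → m′<m , eq)) (m≤m+n _ (up m m′))

-- Residues of factorials and of their products

∈-range1⁺ : ∀ {n N} → 1 ≤ n → n ≤ N → n ∈ range1 N
∈-range1⁺ {suc n} _ n<N = ∈-map⁺ suc (∈-upTo⁺ n<N)

∈-range1⁻ : ∀ {n N} → n ∈ range1 N → 1 ≤ n × n ≤ N
∈-range1⁻ n∈ with ∈-map⁻ suc n∈
... | _ , i∈ , refl = s≤s z≤n , ∈-upTo⁻ i∈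

p∤n! : ∀ {p} → Prime p → ∀ {n} → n < p → ¬ p ∣ n !
p∤n! pr {zero}  _   p∣1 with ∣1⇒≡1 p∣1
... | refl = ¬prime[1] pr
p∤n! pr {suc n} n<p p∣  with euclidsLemma (suc n) (n !) pr p∣
... | inj₁ p∣1+n = contradiction (∣⇒≤ p∣1+n) (<⇒≱ n<p)
... | inj₂ p∣n!  = p∤n! pr (<-trans (n<1+n n) n<p) p∣n!

pred!*n≡n! : ∀ {n} → 1 ≤ n → n * pred n ! ≡ n !
pred!*n≡n! {suc n} _ = refl

module _ {p : ℕ} .{{_ : NonZero p}} (pr : Prime p) {N : ℕ} (1≤N : 1 ≤ N) (N<p : N < p) where

  factResidues prodResidues : List ℕ
  factResidues = deduplicate _≟_ (map (λ n → (n !) % p) (range1 N))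
  prodResidues = deduplicate _≟_ (factProdResidues p N)

  ∈-factResidues⁺ : ∀ {n} → n ≤ N → (n !) % p ∈ factResidues
  ∈-factResidues⁺ {zero}  _   = ∈-factResidues⁺ {1} 1≤N
  ∈-factResidues⁺ {suc n} n<N =
    ∈-deduplicate⁺ _≟_ (∈-map⁺ (λ n → (n !) % p) (∈-range1⁺ {suc n} (s≤s z≤n) n<N))

  ∈-factResidues⁻ : ∀ {a} → a ∈ factResidues → ∃ λ n → 1 ≤ n × n ≤ N × a ≡ (n !) % p
  ∈-factResidues⁻ a∈ with ∈-map⁻ (λ n → (n !) % p) (∈-deduplicate⁻ _≟_ _ a∈)
  ... | n , n∈ , refl = n , proj₁ (∈-range1⁻ n∈) , proj₂ (∈-range1⁻ n∈) , refl

  ∈-prodResidues⁺ : ∀ {n a} → n ≤ N → a ∈ factResidues → (n ! * a) % p ∈ prodResidues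
  ∈-prodResidues⁺ {zero}      _   a∈ = ∈-prodResidues⁺ {1} 1≤N a∈
  ∈-prodResidues⁺ {n@(suc _)} n≤N a∈ with ∈-factResidues⁻ a∈
  ... | k , 1≤k , k≤N , refl = ∈-deduplicate⁺ _≟_
    -- The list is built from `n ! * k !`, whereas `a` is `k !` already reduced.
    (subst (_∈ factProdResidues p N) (*-cong-% (n !) (k !) refl (sym (m%n%n≡m%n (k !) p)))
      (∈-concatMap⁺ _ (lose (∈-range1⁺ {n} (s≤s z≤n) n≤N) (∈-map⁺ _ (∈-range1⁺ 1≤k k≤N)))))

  p∤% : ∀ {n} → ¬ p ∣ n → ¬ p ∣ n % p
  p∤% p∤n p∣n%p = p∤n (∣n∣m%n⇒∣m ∣-refl p∣n%p)

  factResidue-unit : ∀ {a} → a ∈ factResidues → ¬ p ∣ a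
  factResidue-unit a∈ with ∈-factResidues⁻ a∈
  ... | n , _ , n≤N , refl = p∤% (p∤n! pr (≤-<-trans n≤N N<p))

  prodResidue-unit : ∀ {x} → x ∈ prodResidues → ¬ p ∣ x
  prodResidue-unit x∈ with find (∈-concatMap⁻ _ (∈-deduplicate⁻ _≟_ (factProdResidues p N) x∈))
  ... | m , m∈ , x∈′ with ∈-map⁻ (λ n → ((m !) * (n !)) % p) x∈′
  ... | n , n∈ , refl = p∤% ([ unit m∈ , unit n∈ ]′ ∘ euclidsLemma (m !) (n !) pr)
    where
    unit : ∀ {n} → n ∈ range1 N → ¬ p ∣ n !
    unit n∈ = p∤n! pr (≤-<-trans (proj₂ (∈-range1⁻ n∈)) N<p)

  -- The congruence left after cancelling is an equality because the entries of `factResidues` are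
  -- reduced.
  factResidue-cancel : ∀ c {a b} → ¬ p ∣ c → a ∈ factResidues → b ∈ factResidues →
                       (c * a) % p ≡ (c * b) % p → a ≡ b
  factResidue-cancel c {a} {b} p∤c a∈ b∈ eq =
    trans (sym (reduced a∈)) (trans (*-cancelˡ-% pr c a b p∤c eq) (reduced b∈))
    where
    reduced : ∀ {a} → a ∈ factResidues → a % p ≡ a
    reduced a∈ with ∈-factResidues⁻ a∈
    ... | n , _ , _ , refl = m%n%n≡m%n (n !) p

  module Collisions {B : ℕ} (N²≤Bp : N * N ≤ B * p) {ls : List ℕ} (cop : PairwiseCoprimeUpTo N ls) where
    open PairwiseCoprimeUpTo cop

    private
      L = length ls
      as = factResidues
      a = length as
      xs = prodResidues
      K = length xs

      as! : Unique as
      as! = deduplicate-! _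

      xs! : Unique xs
      xs! = deduplicate-! _

      p∤m! : ∀ {m} → m ∈ ls → ¬ p ∣ m !
      p∤m! m∈ = p∤n! pr (≤-<-trans (≤N m∈) N<p)

      pred≤N : ∀ {m} → m ∈ ls → pred m ≤ N
      pred≤N m∈ = ≤-trans pred[n]≤n (≤N m∈)

      p∤pred! : ∀ {m} → m ∈ ls → ¬ p ∣ pred m !
      p∤pred! m∈ = p∤n! pr (≤-<-trans (pred≤N m∈) N<p)

      size : length (cartesianProduct ls as) ≡ L * a
      size = length-cartesianProduct ls as

    -- The part common to both Cauchy-Schwarz arguments, with `ys` equal to AA in one and A in the
    -- other. The diagonal contributes at most L|A|. Off the diagonal the summation is reordered so
    -- that `y` and `y′` are fixed first, and `count-parallel` bounds the pairs `m`, `m′`.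
    collisions-bound : ∀ {ys : List ℕ} → (∀ {y} → y ∈ ys → ¬ p ∣ y) → (f : ℕ × ℕ → ℕ × ℕ → ℕ) →
      (∀ {m m′} → m ∈ ls → m′ ∈ ls → ∑ as (λ b → ∑ as (λ b′ → f (m , b) (m′ , b′))) ≤
         𝟙 (m ≟ m′) * a + ∑ ys (λ y → ∑ ys (λ y′ → 𝟙 (parallel? {p} y y′ m m′)))) →
      ∑ (cartesianProduct ls as) (λ u → ∑ (cartesianProduct ls as) (f u)) ≤
      L * a + length ys * (length ys * (2 * B))
    collisions-bound {ys} units f per-pair = begin
      ∑ (cartesianProduct ls as) (λ u → ∑ (cartesianProduct ls as) (f u))
        ≡⟨ ∑-cartesianProduct ls as _ ⟩
      ∑ ls (λ m → ∑ as (λ b → ∑ (cartesianProduct ls as) (f (m , b))))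
        ≡⟨ ∑-cong ls (λ m → ∑-cong as (λ b → ∑-cartesianProduct ls as (f (m , b)))) ⟩
      ∑ ls (λ m → ∑ as (λ b → ∑ ls (λ m′ → ∑ as (λ b′ → f (m , b) (m′ , b′)))))
        ≡⟨ ∑-cong ls (λ m → ∑-swap as ls _) ⟩
      ∑ ls (λ m → ∑ ls (λ m′ → ∑ as (λ b → ∑ as (λ b′ → f (m , b) (m′ , b′)))))
        ≤⟨ ∑-mono ls (λ m∈ → ∑-mono ls (λ m′∈ → per-pair m∈ m′∈)) ⟩
      ∑ ls (λ m → ∑ ls (λ m′ → 𝟙 (m ≟ m′) * a + off m m′))
        ≡⟨ ∑-cong ls (λ m → ∑-+ ls (λ m′ → 𝟙 (m ≟ m′) * a) (off m)) ⟩
      ∑ ls (λ m → ∑ ls (λ m′ → 𝟙 (m ≟ m′) * a) + ∑ ls (off m))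
        ≡⟨ ∑-+ ls _ _ ⟩
      ∑ ls (λ m → ∑ ls (λ m′ → 𝟙 (m ≟ m′) * a)) + ∑ ls (λ m → ∑ ls (off m))
        ≤⟨ +-mono-≤ diagonal off-diagonal ⟩
      L * a + length ys * (length ys * (2 * B))
        ∎
      where
      open ≤-Reasoning
      off : ℕ → ℕ → ℕ
      off m m′ = ∑ ys (λ y → ∑ ys (λ y′ → 𝟙 (parallel? {p} y y′ m m′)))
      diagonal : ∑ ls (λ m → ∑ ls (λ m′ → 𝟙 (m ≟ m′) * a)) ≤ L * a
      diagonal = begin
        ∑ ls (λ m → ∑ ls (λ m′ → 𝟙 (m ≟ m′) * a))   ≡⟨ ∑-cong ls (λ m → ∑-*ʳ ls a _) ⟩
        ∑ ls (λ m → ∑ ls (λ m′ → 𝟙 (m ≟ m′)) * a)   ≤⟨ ∑-mono ls (λ {m} _ → *-monoˡ-≤ a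
                                                         (∑𝟙≤1 (m ≟_) unique (λ _ _ p q → trans (sym p) q))) ⟩
        ∑ ls (λ _ → 1 * a)                          ≡⟨ ∑-const ls (1 * a) ⟩
        L * (1 * a)                                 ≡⟨ cong (L *_) (*-identityˡ a) ⟩
        L * a                                       ∎
      off-diagonal : ∑ ls (λ m → ∑ ls (off m)) ≤ length ys * (length ys * (2 * B))
      off-diagonal = begin
        ∑ ls (λ m → ∑ ls (λ m′ → ∑ ys (λ y → ∑ ys (λ y′ → 𝟙 (parallel? y y′ m m′)))))
          ≡⟨ ∑-cong ls (λ m → trans (∑-swap ls ys _) (∑-cong ys (λ y → ∑-swap ls ys _))) ⟩
        ∑ ls (λ m → ∑ ys (λ y → ∑ ys (λ y′ → ∑ ls (λ m′ → 𝟙 (parallel? y y′ m m′)))))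
          ≡⟨ trans (∑-swap ls ys _) (∑-cong ys (λ y → ∑-swap ls ys _)) ⟩
        ∑ ys (λ y → ∑ ys (λ y′ → ∑ ls (λ m → ∑ ls (λ m′ → 𝟙 (parallel? y y′ m m′)))))
          ≤⟨ ∑-mono ys (λ {y} y∈ → ∑-mono ys (λ {y′} y′∈ →
               count-parallel {B = B} pr N²≤Bp cop y y′ (units y∈) (units y′∈))) ⟩
        ∑ ys (λ _ → ∑ ys (λ _ → 2 * B))
          ≡⟨ trans (∑-const ys _) (cong (length ys *_) (∑-const ys (2 * B))) ⟩
        length ys * (length ys * (2 * B))
          ∎

    private
      -- For one and the same `m` a collision determines `b′` from `b` by cancelling the unit `c`,
      -- so there are at most |A| of them. The relation `T` is left abstract to cover collisions of
      -- residues and of pairs of residues.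
      same-label : ∀ m c → ¬ p ∣ c → {T : ℕ → ℕ → Set} (T? : ∀ b b′ → Dec (T b b′)) →
        (∀ {b b′} → T b b′ → (c * b) % p ≡ (c * b′) % p) →
        ∑ as (λ b → ∑ as (λ b′ → 𝟙 (T? b b′))) ≤ 𝟙 (m ≟ m) * a
      same-label m c p∤c T? h = begin
        ∑ as (λ b → ∑ as (λ b′ → 𝟙 (T? b b′)))  ≤⟨ ∑-mono as (λ {b} b∈ → ∑𝟙≤1 (T? b) as! (λ i j t t′ →
                                                     factResidue-cancel c p∤c i j (trans (sym (h t)) (h t′)))) ⟩
        ∑ as (λ _ → 1)                          ≡⟨ ∑-const as 1 ⟩
        a * 1                                   ≡⟨ *-comm a 1 ⟩
        1 * a                                   ≤⟨ *-monoˡ-≤ a (𝟙-true (m ≟ m) refl) ⟩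
        𝟙 (m ≟ m) * a                           ∎
        where open ≤-Reasoning

    -- The collisions of (m , b) ↦ m! b with m ≢ m′ are read off from y = (m-1)! b and y′ = (m′-1)! b′.
    |ls|²|A|²≤|AA|[|ls||A|+2B|AA|²] : (L * a) * (L * a) ≤ K * (L * a + K * (K * (2 * B)))
    |ls|²|A|²≤|AA|[|ls||A|+2B|AA|²] = begin
      (L * a) * (L * a)
        ≡⟨ cong₂ _*_ size size ⟨
      length (cartesianProduct ls as) * length (cartesianProduct ls as)
        ≤⟨ length²≤values*collisions _≟_ (cartesianProduct ls as) f xs! f∈ ⟩
      K * ∑ (cartesianProduct ls as) (λ u → ∑ (cartesianProduct ls as) (λ v → 𝟙 (f u ≟ f v)))
        ≤⟨ *-monoʳ-≤ K (collisions-bound prodResidue-unit (λ u v → 𝟙 (f u ≟ f v)) per-pair) ⟩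
      K * (L * a + K * (K * (2 * B)))
        ∎
      where
      open ≤-Reasoning
      f : ℕ × ℕ → ℕ
      f (m , b) = (m ! * b) % p
      f∈ : ∀ {u} → u ∈ cartesianProduct ls as → f u ∈ xs
      f∈ u∈ with ∈-cartesianProduct⁻ ls as u∈
      ... | m∈ , b∈ = ∈-prodResidues⁺ (≤N m∈) b∈
      g : ℕ → ℕ → ℕ
      g m b = (pred m ! * b) % p
      g*m : ∀ {m} b → m ∈ ls → (g m b * m) % p ≡ f (m , b)
      g*m {m} b m∈ = begin-equality
        ((pred m ! * b) % p * m) % p   ≡⟨ *-cong-% ((pred m ! * b) % p) m (m%n%n≡m%n (pred m ! * b) p) refl ⟩
        (pred m ! * b * m) % p         ≡⟨ cong (_% p) (rearrange (pred m !) b m) ⟩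
        (m * pred m ! * b) % p         ≡⟨ cong (λ k → (k * b) % p) (pred!*n≡n! (1≤ m∈)) ⟩
        (m ! * b) % p                  ∎
        where
        rearrange : ∀ c b m → c * b * m ≡ m * c * b
        rearrange = solve-∀
      -- Multiplication by (m-1)! is injective from A into AA, so a sum over `b` may be enlarged to
      -- a sum over all of AA, a range that does not depend on `m`.
      inject : ∀ {m} → m ∈ ls → (h : ℕ → ℕ) → ∑ as (h ∘ g m) ≤ ∑ xs h
      inject {m} m∈ h = ∑-injection _≟_ (g m) h as! (∈-prodResidues⁺ (pred≤N m∈))
        (λ i j → factResidue-cancel (pred m !) (p∤pred! m∈) i j)
      per-pair : ∀ {m m′} → m ∈ ls → m′ ∈ ls → ∑ as (λ b → ∑ as (λ b′ → 𝟙 (f (m , b) ≟ f (m′ , b′)))) ≤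
        𝟙 (m ≟ m′) * a + ∑ xs (λ y → ∑ xs (λ y′ → 𝟙 (parallel? {p} y y′ m m′)))
      per-pair {m} {m′} m∈ m′∈ = case (m ≟ m′)
        where
        case : Dec (m ≡ m′) → _
        case (yes refl) = ≤-trans (same-label m (m !) (p∤m! m∈) (λ b b′ → f (m , b) ≟ f (m , b′)) (λ e → e)) (m≤m+n _ _)
        case (no m≢m′)  = begin
          ∑ as (λ b → ∑ as (λ b′ → 𝟙 (f (m , b) ≟ f (m′ , b′))))
            ≤⟨ ∑-mono as (λ {b} _ → ∑-mono as (λ {b′} _ → 𝟙-mono (f (m , b) ≟ f (m′ , b′))
                 (parallel? (g m b) (g m′ b′) m m′)
                 (λ eq → m≢m′ , trans (g*m b m∈) (trans eq (sym (g*m b′ m′∈)))))) ⟩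
          ∑ as (λ b → ∑ as (λ b′ → 𝟙 (parallel? (g m b) (g m′ b′) m m′)))
            ≤⟨ ∑-mono as (λ {b} _ → inject m′∈ (λ y′ → 𝟙 (parallel? (g m b) y′ m m′))) ⟩
          ∑ as (λ b → ∑ xs (λ y′ → 𝟙 (parallel? (g m b) y′ m m′)))
            ≤⟨ inject m∈ (λ y → ∑ xs (λ y′ → 𝟙 (parallel? y y′ m m′))) ⟩
          ∑ xs (λ y → ∑ xs (λ y′ → 𝟙 (parallel? y y′ m m′)))
            ≤⟨ m≤n+m _ (𝟙 (m ≟ m′) * a) ⟩
          𝟙 (m ≟ m′) * a + ∑ xs (λ y → ∑ xs (λ y′ → 𝟙 (parallel? y y′ m m′)))
            ∎

    -- If m! = m′! then (m-1)! e = (m′-1)! e′ amounts to e′ m = e m′.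
    |ls|²|A|²≤|A||AA|[|ls||A|+2B|A|²] : (L * a) * (L * a) ≤ (a * K) * (L * a + a * (a * (2 * B)))
    |ls|²|A|²≤|A||AA|[|ls||A|+2B|A|²] = begin
      (L * a) * (L * a)
        ≡⟨ cong₂ _*_ size size ⟨
      length (cartesianProduct ls as) * length (cartesianProduct ls as)
        ≤⟨ length²≤values*collisions _≟₂_ (cartesianProduct ls as) f (Unique.cartesianProduct⁺ as! xs!) f∈ ⟩
      length (cartesianProduct as xs) *
        ∑ (cartesianProduct ls as) (λ u → ∑ (cartesianProduct ls as) (λ v → 𝟙 (f u ≟₂ f v)))
        ≤⟨ *-mono-≤ (≤-reflexive (length-cartesianProduct as xs))
             (collisions-bound factResidue-unit (λ u v → 𝟙 (f u ≟₂ f v)) per-pair) ⟩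
      (a * K) * (L * a + a * (a * (2 * B)))
        ∎
      where
      open ≤-Reasoning
      _≟₂_ : DecidableEquality (ℕ × ℕ)
      _≟₂_ = ≡-dec _≟_ _≟_
      f : ℕ × ℕ → ℕ × ℕ
      f (m , e) = (m !) % p , (pred m ! * e) % p
      f∈ : ∀ {u} → u ∈ cartesianProduct ls as → f u ∈ cartesianProduct as xs
      f∈ u∈ with ∈-cartesianProduct⁻ ls as u∈
      ... | m∈ , e∈ = ∈-cartesianProduct⁺ (∈-factResidues⁺ (≤N m∈)) (∈-prodResidues⁺ (pred≤N m∈) e∈)
      -- After multiplication by m!, the first coordinate replaces m! by m′! = m′ (m′-1)!, the
      -- second replaces (m′-1)! e′ by (m-1)! e, and m! is restored and cancelled.
      cross : ∀ {m m′ e e′} → m ∈ ls → m′ ∈ ls → f (m , e) ≡ f (m′ , e′) → (e′ * m) % p ≡ (e * m′) % p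
      cross {m} {m′} {e} {e′} m∈ m′∈ eq = *-cancelˡ-% pr (m !) _ _ (p∤m! m∈) (begin-equality
        (m ! * (e′ * m)) % p                 ≡⟨ *-cong-% (m !) (e′ * m) (cong proj₁ eq) refl ⟩
        (m′ ! * (e′ * m)) % p                ≡⟨ cong (λ k → (k * (e′ * m)) % p) (pred!*n≡n! (1≤ m′∈)) ⟨
        (m′ * pred m′ ! * (e′ * m)) % p      ≡⟨ cong (_% p) (rearrange m′ (pred m′ !) e′ m) ⟩
        ((m′ * m) * (pred m′ ! * e′)) % p    ≡⟨ *-cong-% (m′ * m) (pred m′ ! * e′) refl (sym (cong proj₂ eq)) ⟩
        ((m′ * m) * (pred m ! * e)) % p      ≡⟨ cong (_% p) (rearrange′ m′ m (pred m !) e) ⟩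
        (m * pred m ! * (e * m′)) % p        ≡⟨ cong (λ k → (k * (e * m′)) % p) (pred!*n≡n! (1≤ m∈)) ⟩
        (m ! * (e * m′)) % p                 ∎)
        where
        rearrange : ∀ m′ c e′ m → m′ * c * (e′ * m) ≡ (m′ * m) * (c * e′)
        rearrange = solve-∀
        rearrange′ : ∀ m′ m c e → (m′ * m) * (c * e) ≡ m * c * (e * m′)
        rearrange′ = solve-∀
      per-pair : ∀ {m m′} → m ∈ ls → m′ ∈ ls → ∑ as (λ e → ∑ as (λ e′ → 𝟙 (f (m , e) ≟₂ f (m′ , e′)))) ≤
        𝟙 (m ≟ m′) * a + ∑ as (λ y → ∑ as (λ y′ → 𝟙 (parallel? {p} y y′ m m′)))
      per-pair {m} {m′} m∈ m′∈ = case (m ≟ m′)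
        where
        case : Dec (m ≡ m′) → _
        case (yes refl) = ≤-trans (same-label m (pred m !) (p∤pred! m∈) (λ e e′ → f (m , e) ≟₂ f (m , e′)) (cong proj₂))
                            (m≤m+n _ _)
        case (no m≢m′)  = begin
          ∑ as (λ e → ∑ as (λ e′ → 𝟙 (f (m , e) ≟₂ f (m′ , e′))))
            ≤⟨ ∑-mono as (λ {e} _ → ∑-mono as (λ {e′} _ → 𝟙-mono (f (m , e) ≟₂ f (m′ , e′))
                 (parallel? e′ e m m′) (λ eq → m≢m′ , cross {e = e} m∈ m′∈ eq))) ⟩
          ∑ as (λ e → ∑ as (λ e′ → 𝟙 (parallel? e′ e m m′)))
            -- `cross` pairs `e′` with `m`, so the two summation variables trade places.
            ≡⟨ ∑-swap as as _ ⟩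
          ∑ as (λ y → ∑ as (λ y′ → 𝟙 (parallel? y y′ m m′)))
            ≤⟨ m≤n+m _ (𝟙 (m ≟ m′) * a) ⟩
          𝟙 (m ≟ m′) * a + ∑ as (λ y → ∑ as (λ y′ → 𝟙 (parallel? y y′ m m′)))
            ∎

-- Primes

primes : ℕ → List ℕ
primes N = filter prime? (range1 N)

-- Being coprime to everything, 1 may be adjoined; the length π(N) + 1 is then positive even for N =
-- 1, which absorbs the additive constant in `N≤2+ℓπ`.
labels : ℕ → List ℕ
labels N = 1 ∷ primes N

primes-coprime : ∀ {q r} → Prime q → Prime r → q ≢ r → Coprime q r
primes-coprime {q} {r} pq pr q≢r with <-cmp q r
... | tri< q<r _ _ = Coprime.sym (prime⇒coprime pr {{prime⇒nonZero pq}} q<r)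
... | tri≈ _ q≡r _ = contradiction q≡r q≢r
... | tri> _ _ r<q = prime⇒coprime pq {{prime⇒nonZero pr}} r<q

labels-pairwiseCoprime : ∀ {N} → 1 ≤ N → PairwiseCoprimeUpTo N (labels N)
labels-pairwiseCoprime {N} 1≤N = record
  { unique  = All.tabulate (λ q∈ 1≡q → ¬prime[1] (subst Prime (sym 1≡q) (is-prime q∈)))
              ∷ Unique.filter⁺ prime? (Unique.map⁺ suc-injective (Unique.upTo⁺ N))
  ; 1≤_     = λ { (here refl) → ≤-refl ; (there q∈) → proj₁ (∈-range1⁻ (in-range q∈)) }
  ; ≤N_     = λ { (here refl) → 1≤N    ; (there q∈) → proj₂ (∈-range1⁻ (in-range q∈)) }
  ; coprime = λ { (here refl) _           _   → 1-coprimeTo _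
                ; (there _)   (here refl) _   → Coprime.sym (1-coprimeTo _)
                ; (there q∈)  (there r∈)  q≢r → primes-coprime (is-prime q∈) (is-prime r∈) q≢r }
  }
  where
  is-prime : ∀ {q} → q ∈ primes N → Prime q
  is-prime q∈ = proj₂ (∈-filter⁻ prime? {xs = range1 N} q∈)
  in-range : ∀ {q} → q ∈ primes N → q ∈ range1 N
  in-range q∈ = proj₁ (∈-filter⁻ prime? {xs = range1 N} q∈)

-- Prime powers, common multiples and Chebyshev's bound

n<q^n : ∀ {q} → 2 ≤ q → ∀ n → n < q ^ n
n<q^n     2≤q zero    = s≤s z≤n
n<q^n {q} 2≤q (suc n) = begin-strict
  suc n          ≤⟨ n<q^n 2≤q n ⟩
  q ^ n          <⟨ m<m*n (q ^ n) q {{>-nonZero (≤-<-trans z≤n (n<q^n 2≤q n))}} 2≤q ⟩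
  q ^ n * q      ≡⟨ *-comm (q ^ n) q ⟩
  q * q ^ n      ∎
  where open ≤-Reasoning

^-distribʳ-* : ∀ o m n → (m * n) ^ o ≡ m ^ o * n ^ o
^-distribʳ-* zero    m n = refl
^-distribʳ-* (suc o) m n rewrite ^-distribʳ-* o m n = rearrange m n (m ^ o) (n ^ o)
  where
  rearrange : ∀ a b c d → a * b * (c * d) ≡ a * c * (b * d)
  rearrange = solve-∀

^-monoʳ-∣ : ∀ q {e k} → e ≤ k → q ^ e ∣ q ^ k
^-monoʳ-∣ q {e} {k} e≤k =
  subst (q ^ e ∣_) (trans (sym (^-distribˡ-+-* q e (k ∸ e))) (cong (q ^_) (m+[n∸m]≡n e≤k))) (m∣m*n _)

-- The witness is the largest power of `q` up to `n`, searched downwards from `q ^ n`; its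
-- maximality is recorded as divisibility by all powers of `q` up to `n`.
largest-power : ∀ {q n} → 2 ≤ q → 1 ≤ n → ∃ λ c → 1 ≤ c × c ≤ n × (∀ e → q ^ e ≤ n → q ^ e ∣ c)
largest-power {q} {n} 2≤q 1≤n with search n
  where
  search : ∀ k → ∃ λ c → 1 ≤ c × c ≤ n × (∀ e → e ≤ k → q ^ e ≤ n → q ^ e ∣ c)
  search zero = 1 , ≤-refl , 1≤n , λ { zero _ _ → ∣-refl }
  search (suc k) with q ^ suc k ≤? n
  ... | yes q^k≤n = q ^ suc k , ≤-trans (s≤s z≤n) (n<q^n 2≤q (suc k)) , q^k≤n , λ e e≤k _ → ^-monoʳ-∣ q e≤k
  ... | no  q^k≰n with search k
  ... | c , 1≤c , c≤n , h = c , 1≤c , c≤n , λ e e≤1+k q^e≤n →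
    h e (s≤s⁻¹ (≤∧≢⇒< e≤1+k λ { refl → q^k≰n q^e≤n })) q^e≤n
-- Exponents up to `n` suffice, since `e < q ^ e ≤ n`.
... | c , 1≤c , c≤n , h = c , 1≤c , c≤n , λ e q^e≤n →
  h e (<⇒≤ (<-≤-trans (n<q^n 2≤q e) q^e≤n)) q^e≤n

split-off-power : ∀ {q} → 2 ≤ q → ∀ m → 1 ≤ m → ∃₂ λ e m′ → m ≡ q ^ e * m′ × ¬ q ∣ m′
split-off-power {q} 2≤q = <-rec _ go
  where
  go : ∀ m → (∀ {k} → k < m → 1 ≤ k → ∃₂ λ e m′ → k ≡ q ^ e * m′ × ¬ q ∣ m′) →
       1 ≤ m → ∃₂ λ e m′ → m ≡ q ^ e * m′ × ¬ q ∣ m′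
  go m rec 1≤m with q ∣? m
  ... | no  q∤m              = 0 , m , sym (*-identityˡ m) , q∤m
  ... | yes (divides k refl) with k in eq
  ... | zero   = contradiction 1≤m λ ()
  ... | suc k′ with rec (m<m*n (suc k′) q 2≤q) (s≤s z≤n)
  ... | e , m′ , k≡ , q∤m′ = suc e , m′ , trans (cong (_* q) k≡) (rearrange (q ^ e) m′ q) , q∤m′
    where
    rearrange : ∀ c m q → c * m * q ≡ q * c * m
    rearrange = solve-∀

no-prime-divisor⇒≡1 : ∀ m → 1 ≤ m → (∀ q → Prime q → ¬ q ∣ m) → m ≡ 1
no-prime-divisor⇒≡1 m 1≤m none with factorise m {{>-nonZero 1≤m}}
... | record { factors = []     ; isFactorisation = m≡1 } = m≡1
... | record { factors = q ∷ qs ; isFactorisation = m≡  ; factorsPrime = pq ∷ _ } =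
  contradiction (subst (q ∣_) (sym m≡) (m∣m*n _)) (none q pq)

-- `D` is the product over `qs` of the largest powers up to `n`, hence at most `n` per prime. To
-- divide it by `m`, the power of the first prime is split off and the cofactor is left to the
-- remaining primes. With all primes up to `n` it serves as lcm(1, ..., n).
smooth-common-multiple : ∀ {n} → 1 ≤ n → ∀ qs → All Prime qs →
  ∃ λ D → 1 ≤ D × D ≤ n ^ length qs ×
    (∀ m → 1 ≤ m → m ≤ n → (∀ r → Prime r → r ∣ m → r ∈ qs) → m ∣ D)
smooth-common-multiple 1≤n [] [] = 1 , ≤-refl , ≤-refl , λ m 1≤m _ h →
  ∣-reflexive (no-prime-divisor⇒≡1 m 1≤m (λ r pr r∣m → contradiction (h r pr r∣m) λ ()))
smooth-common-multiple {n} 1≤n (q ∷ qs) (pq ∷ pqs)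
  with largest-power {q} {n} 2≤q 1≤n | smooth-common-multiple 1≤n qs pqs
  where 2≤q = nonTrivial⇒n>1 q {{prime⇒nonTrivial pq}}
... | c , 1≤c , c≤n , powers | D , 1≤D , D≤ , multiples =
  c * D , *-mono-≤ 1≤c 1≤D , *-mono-≤ c≤n D≤ , divides-cD
  where
  divides-cD : ∀ m → 1 ≤ m → m ≤ n → (∀ r → Prime r → r ∣ m → r ∈ q ∷ qs) → m ∣ c * D
  divides-cD m 1≤m m≤n h with split-off-power (nonTrivial⇒n>1 q {{prime⇒nonTrivial pq}}) m 1≤m
  ... | e , m′ , refl , q∤m′ = *-pres-∣ (powers e (≤-trans (∣⇒≤ {{>-nonZero 1≤m}} (m∣m*n m′)) m≤n))
    (multiples m′ 1≤m′ (≤-trans (∣⇒≤ {{>-nonZero 1≤m}} (n∣m*n (q ^ e))) m≤n) in-qs)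
    where
    1≤m′ : 1 ≤ m′
    1≤m′ = n≢0⇒n>0 λ { refl → q∤m′ (q ∣0) }
    in-qs : ∀ r → Prime r → r ∣ m′ → r ∈ qs
    in-qs r pr r∣m′ with h r pr (∣n⇒∣m*n (q ^ e) r∣m′)
    ... | here refl = contradiction r∣m′ q∤m′
    ... | there r∈  = r∈

-- The quotient `t` is (i+j+1) times a binomial coefficient, a denominator in Leibniz's harmonic
-- triangle.
i!j!∣[1+i+j]! : ∀ i j → ∃ λ t → t * (i ! * j !) ≡ suc (i + j) !
i!j!∣[1+i+j]! i j with k![n∸k]!∣n! {i + j} {i} (m≤m+n i j)
... | divides c eq = suc (i + j) * c , (begin
  suc (i + j) * c * (i ! * j !)                 ≡⟨ *-assoc (suc (i + j)) c _ ⟩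
  suc (i + j) * (c * (i ! * j !))               ≡⟨ cong (λ k → suc (i + j) * (c * (i ! * k !))) (m+n∸m≡n i j) ⟨
  suc (i + j) * (c * (i ! * (i + j ∸ i) !))     ≡⟨ cong (suc (i + j) *_) eq ⟨
  suc (i + j) * (i + j) !                       ∎)
  where open ≡-Reasoning

-- With t(i,j) = (i+j+1)!/(i!j!), the rule 1/t(i+1,j) = 1/t(i,j) - 1/t(i,j+1) of Leibniz's
-- harmonic triangle shows inductively that every D/t(i,j) is an integer.
leibniz-∣ : ∀ {n D} → (∀ k → 1 ≤ k → k ≤ n → k ∣ D) →
            ∀ i j t → i + j < n → t * (i ! * j !) ≡ suc (i + j) ! → t ∣ D
leibniz-∣ {n} {D} divides-D zero j t j<n eq = subst (_∣ D) (sym t≡) (divides-D (suc j) (s≤s z≤n) j<n)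
  where
  t≡ : t ≡ suc j
  t≡ = *-cancelʳ-≡ t (suc j) (j !) {{j !≢0}} (trans (cong (t *_) (sym (*-identityˡ (j !)))) eq)
leibniz-∣ {n} {D} divides-D (suc i) j t i+j<n eq
  with i!j!∣[1+i+j]! i j | i!j!∣[1+i+j]! i (suc j)
... | u , u≡ | v , v≡
  with leibniz-∣ divides-D i j u (<-trans (n<1+n _) i+j<n) u≡
     | leibniz-∣ divides-D i (suc j) v (subst (_< n) (sym (+-suc i j)) i+j<n) v≡
... | divides a D≡au | divides b D≡bv = divides (a ∸ b) (*-cancelˡ-≡ D _ (suc i) (sym (begin
  suc i * ((a ∸ b) * t)          ≡⟨ swap (suc i) (a ∸ b) t ⟩
  (a ∸ b) * (suc i * t)          ≡⟨ cong ((a ∸ b) *_) t-rule ⟩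
  (a ∸ b) * (s * u)              ≡⟨ *-distribʳ-∸ (s * u) a b ⟩
  a * (s * u) ∸ b * (s * u)      ≡⟨ cong₂ _∸_ (swap a s u) (cong (b *_) (sym v-rule)) ⟩
  s * (a * u) ∸ b * (suc j * v)  ≡⟨ cong₂ _∸_ (cong (s *_) (sym D≡au)) (trans (swap b (suc j) v) (cong (suc j *_) (sym D≡bv))) ⟩
  s * D ∸ suc j * D              ≡⟨ *-distribʳ-∸ D s (suc j) ⟨
  (s ∸ suc j) * D                ≡⟨ cong (_* D) (m+n∸n≡m (suc i) j) ⟩
  suc i * D                      ∎)))
  where
  open ≡-Reasoning
  s = suc (suc (i + j))
  swap : ∀ x y z → x * (y * z) ≡ y * (x * z)
  swap = solve-∀
  instance
    i!j!≢0 : NonZero (i ! * j !)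
    i!j!≢0 = i !* j !≢0
  -- With `v-rule` this gives 1/u - 1/v = (s - (j+1))/(su) = (i+1)/(su) = 1/t, so D/t is `a ∸ b`.
  t-rule : suc i * t ≡ s * u
  t-rule = *-cancelʳ-≡ (suc i * t) (s * u) (i ! * j !) (begin
    suc i * t * (i ! * j !)        ≡⟨ rearrange (suc i) t (i !) (j !) ⟩
    t * (suc i * i ! * j !)        ≡⟨ eq ⟩
    s * (suc (i + j) !)            ≡⟨ cong (s *_) u≡ ⟨
    s * (u * (i ! * j !))          ≡⟨ *-assoc s u _ ⟨
    s * u * (i ! * j !)            ∎)
    where
    rearrange : ∀ x t y z → x * t * (y * z) ≡ t * (x * y * z)
    rearrange = solve-∀
  v-rule : suc j * v ≡ s * u
  v-rule = *-cancelʳ-≡ (suc j * v) (s * u) (i ! * j !) (begin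
    suc j * v * (i ! * j !)        ≡⟨ rearrange (suc j) v (i !) (j !) ⟩
    v * (i ! * (suc j * j !))      ≡⟨ v≡ ⟩
    suc (i + suc j) !              ≡⟨ cong (λ k → suc k !) (+-suc i j) ⟩
    s * (suc (i + j) !)            ≡⟨ cong (s *_) u≡ ⟨
    s * (u * (i ! * j !))          ≡⟨ *-assoc s u _ ⟨
    s * u * (i ! * j !)            ∎)
    where
    rearrange : ∀ x t y z → x * t * (y * z) ≡ t * (y * (x * z))
    rearrange = solve-∀

-- Thus t(m,m) is at least 4^m. The inductive step multiplies the left side by (2m+2)² and the right
-- side by (2m+3)(2m+2).
4^m*m!²≤[1+2m]! : ∀ m → 4 ^ m * (m ! * m !) ≤ suc (m + m) !
4^m*m!²≤[1+2m]! zero    = ≤-refl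
4^m*m!²≤[1+2m]! (suc m) = begin
  4 * 4 ^ m * (suc m * m ! * (suc m * m !))            ≡⟨ rearrange (4 ^ m) (suc m) (m !) ⟩
  2 * suc m * (2 * suc m) * (4 ^ m * (m ! * m !))      ≤⟨ *-mono-≤ (*-mono-≤ bound₁ bound₂) (4^m*m!²≤[1+2m]! m) ⟩
  suc (suc (suc (m + m))) * suc (suc (m + m)) * suc (m + m) !   ≡⟨ *-assoc (suc (suc (suc (m + m)))) (suc (suc (m + m))) (suc (m + m) !) ⟩
  suc (suc (suc (m + m))) !                            ≡⟨ cong (λ k → suc (suc k) !) (+-suc m m) ⟨
  suc (suc m + suc m) !                                ∎
  where
  open ≤-Reasoning
  rearrange : ∀ c s f → 4 * c * (s * f * (s * f)) ≡ 2 * s * (2 * s) * (c * (f * f))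
  rearrange = solve-∀
  double : ∀ m → 2 * suc m ≡ suc (suc (m + m))
  double = solve-∀
  bound₂ : 2 * suc m ≤ suc (suc (m + m))
  bound₂ = ≤-reflexive (double m)
  bound₁ : 2 * suc m ≤ suc (suc (suc (m + m)))
  bound₁ = m≤n⇒m≤1+n bound₂

-- Nair's argument: t(m,m) divides a common multiple `D` of 1, ..., N with at most π(N) factors,
-- each at most N, so 4^m ≤ t ≤ D ≤ N^π(N). Rounding N to 2m + 2 costs the factor 4.
chebyshev : ∀ N → 1 ≤ N → 2 ^ N ≤ 4 * N ^ length (primes N)
chebyshev N@(suc n) 1≤N
  with smooth-common-multiple {N} 1≤N (primes N) (All.tabulate (λ q∈ → proj₂ (∈-filter⁻ prime? {xs = range1 N} q∈)))
... | D , 1≤D , D≤ , multiples with i!j!∣[1+i+j]! (n / 2) (n / 2)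
... | t , t≡ = begin
  2 ^ N              ≤⟨ ^-monoʳ-≤ 2 N≤2+2m ⟩
  2 ^ (2 + 2 * m)    ≡⟨ ^-distribˡ-+-* 2 2 (2 * m) ⟩
  4 * 2 ^ (2 * m)    ≡⟨ cong (4 *_) (^-*-assoc 2 2 m) ⟨
  4 * 4 ^ m          ≤⟨ *-monoʳ-≤ 4 4^m≤t ⟩
  4 * t              ≤⟨ *-monoʳ-≤ 4 (∣⇒≤ {{>-nonZero 1≤D}} t∣D) ⟩
  4 * D              ≤⟨ *-monoʳ-≤ 4 D≤ ⟩
  4 * N ^ length (primes N)  ∎
  where
  open ≤-Reasoning
  -- The largest `m` with 2m + 1 ≤ N, as `leibniz-∣` requires.
  m = n / 2
  m+m≤n : m + m ≤ n
  m+m≤n = subst (_≤ n) (double m) (m/n*n≤m n 2)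
    where
    double : ∀ m → m * 2 ≡ m + m
    double = solve-∀
  N≤2+2m : N ≤ 2 + 2 * m
  N≤2+2m = begin-strict
    n                     ≡⟨ m≡m%n+[m/n]*n n 2 ⟩
    n % 2 + m * 2         <⟨ +-monoˡ-< (m * 2) (m%n<n n 2) ⟩
    2 + m * 2             ≡⟨ cong (2 +_) (*-comm m 2) ⟩
    2 + 2 * m             ∎
  4^m≤t : 4 ^ m ≤ t
  4^m≤t = *-cancelʳ-≤ (4 ^ m) t (m ! * m !) {{m !* m !≢0}}
            (≤-trans (4^m*m!²≤[1+2m]! m) (≤-reflexive (sym t≡)))
  t∣D : t ∣ D
  t∣D = leibniz-∣ {N} (λ k 1≤k k≤N → multiples k 1≤k k≤N (λ r pr r∣k →
          ∈-filter⁺ prime? (∈-range1⁺ (>-nonZero⁻¹ r {{prime⇒nonZero pr}})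
            (≤-trans (∣⇒≤ {{>-nonZero 1≤k}} r∣k) k≤N)) pr)) m m t (s≤s m+m≤n) t≡

-- Density of the primes up to a logarithm

binary-length : ∀ N → 1 ≤ N → ∃ λ ℓ → N ≤ 2 ^ ℓ × 2 ^ ℓ ≤ 2 * N
binary-length (suc zero)    _ = 0 , ≤-refl , s≤s z≤n
binary-length (suc N@(suc _)) _ with binary-length N (s≤s z≤n)
... | ℓ , N≤2^ℓ , 2^ℓ≤2N with suc N ≤? 2 ^ ℓ
... | yes 1+N≤2^ℓ = ℓ , 1+N≤2^ℓ , ≤-trans 2^ℓ≤2N (*-monoʳ-≤ 2 (n≤1+n N))
... | no  1+N≰2^ℓ = suc ℓ , lower , *-monoʳ-≤ 2 (<⇒≤ (≰⇒> 1+N≰2^ℓ))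
  where
  open ≤-Reasoning
  lower : suc N ≤ 2 * 2 ^ ℓ
  lower = begin
    1 + N          ≤⟨ +-monoˡ-≤ N (s≤s z≤n) ⟩
    N + N          ≡⟨ cong (N +_) (+-identityʳ N) ⟨
    2 * N          ≤⟨ *-monoʳ-≤ 2 N≤2^ℓ ⟩
    2 * 2 ^ ℓ      ∎

2^-cancel-≤ : ∀ {m n} → 2 ^ m ≤ 2 ^ n → m ≤ n
2^-cancel-≤ {m} {n} h with m ≤? n
... | yes m≤n = m≤n
... | no  m≰n = contradiction h (<⇒≱ (^-monoʳ-< 2 (s≤s (s≤s z≤n)) (≰⇒> m≰n)))

-- The inequality n ≤ t 2^⌊n/t⌋ is raised to the power `t`. It serves to bound powers of a logarithm
-- of N by a constant times N.
n^t≤t^t*2^n : ∀ t n → .{{_ : NonZero t}} → n ^ t ≤ t ^ t * 2 ^ n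
n^t≤t^t*2^n t n = begin
  n ^ t                       ≤⟨ ^-monoˡ-≤ t n≤ ⟩
  (t * 2 ^ (n / t)) ^ t       ≡⟨ ^-distribʳ-* t t (2 ^ (n / t)) ⟩
  t ^ t * (2 ^ (n / t)) ^ t   ≡⟨ cong (t ^ t *_) (^-*-assoc 2 (n / t) t) ⟩
  t ^ t * 2 ^ (n / t * t)     ≤⟨ *-monoʳ-≤ (t ^ t) (^-monoʳ-≤ 2 (m/n*n≤m n t)) ⟩
  t ^ t * 2 ^ n               ∎
  where
  open ≤-Reasoning
  n≤ : n ≤ t * 2 ^ (n / t)
  n≤ = begin
    n                       ≡⟨ m≡m%n+[m/n]*n n t ⟩
    n % t + n / t * t       ≤⟨ +-monoˡ-≤ _ (m%n≤n n t) ⟩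
    t + n / t * t           ≡⟨ *-comm (suc (n / t)) t ⟩
    t * suc (n / t)         ≤⟨ *-monoʳ-≤ t (n<q^n ≤-refl (n / t)) ⟩
    t * 2 ^ (n / t)         ∎

-- This is L ≫ N^(1-1/t) without roots. With ℓ in place of log₂ N, `chebyshev` gives N ≤ 2(ℓ+1)L,
-- and (ℓ+1)^t is at most 4 t^t N.
labels-dense : ∀ t → .{{_ : NonZero t}} → ∀ N → 1 ≤ N →
               N ^ t ≤ 2 ^ t * t ^ t * 4 * (N * length (labels N) ^ t)
labels-dense t N 1≤N with binary-length N 1≤N
... | ℓ , N≤2^ℓ , 2^ℓ≤2N = begin
  N ^ t                                          ≤⟨ ^-monoˡ-≤ t N≤2ℓL ⟩
  (2 * suc ℓ * L) ^ t                            ≡⟨ trans (^-distribʳ-* t (2 * suc ℓ) L) (cong (_* L ^ t) (^-distribʳ-* t 2 (suc ℓ))) ⟩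
  2 ^ t * suc ℓ ^ t * L ^ t                      ≤⟨ *-monoˡ-≤ (L ^ t) (*-monoʳ-≤ (2 ^ t) (n^t≤t^t*2^n t (suc ℓ))) ⟩
  2 ^ t * (t ^ t * (2 * 2 ^ ℓ)) * L ^ t          ≤⟨ *-monoˡ-≤ (L ^ t) (*-monoʳ-≤ (2 ^ t) (*-monoʳ-≤ (t ^ t) (*-monoʳ-≤ 2 2^ℓ≤2N))) ⟩
  2 ^ t * (t ^ t * (2 * (2 * N))) * L ^ t        ≡⟨ rearrange (2 ^ t) (t ^ t) N (L ^ t) ⟩
  2 ^ t * t ^ t * 4 * (N * L ^ t)                ∎
  where
  open ≤-Reasoning
  π = length (primes N)
  L = length (labels N)
  rearrange : ∀ a b n l → a * (b * (2 * (2 * n))) * l ≡ a * b * 4 * (n * l)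
  rearrange = solve-∀
  N≤2+ℓπ : N ≤ 2 + ℓ * π
  N≤2+ℓπ = 2^-cancel-≤ (begin
    2 ^ N                  ≤⟨ chebyshev N 1≤N ⟩
    4 * N ^ π              ≤⟨ *-monoʳ-≤ 4 (^-monoˡ-≤ π N≤2^ℓ) ⟩
    4 * (2 ^ ℓ) ^ π        ≡⟨ cong (4 *_) (^-*-assoc 2 ℓ π) ⟩
    4 * 2 ^ (ℓ * π)        ≡⟨ ^-distribˡ-+-* 2 2 (ℓ * π) ⟨
    2 ^ (2 + ℓ * π)        ∎)
  N≤2ℓL : N ≤ 2 * suc ℓ * L
  N≤2ℓL = begin
    N                                        ≤⟨ N≤2+ℓπ ⟩
    2 + ℓ * π                                ≤⟨ m≤m+n _ _ ⟩
    2 + ℓ * π + (ℓ * π + 2 * ℓ + 2 * π)      ≡⟨ expand ℓ π ⟩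
    2 * suc ℓ * suc π                        ∎
    where
    expand : ∀ ℓ π → 2 + ℓ * π + (ℓ * π + 2 * ℓ + 2 * π) ≡ 2 * suc ℓ * suc π
    expand = solve-∀

-- The bound for |AA|

length≤N : ∀ {N ls} → PairwiseCoprimeUpTo N ls → length ls ≤ N
length≤N {N} {ls} cop = begin
  length ls                ≡⟨ trans (∑-const ls 1) (*-identityʳ _) ⟨
  ∑ ls (λ _ → 1)           ≤⟨ ∑-injection _≟_ (λ m → m) (λ _ → 1) unique
                                (λ m∈ → ∈-range1⁺ (1≤ m∈) (≤N m∈)) (λ _ _ eq → eq) ⟩
  ∑ (range1 N) (λ _ → 1)   ≡⟨ trans (∑-const (range1 N) 1) (*-identityʳ _) ⟩
  length (range1 N)        ≡⟨ trans (length-map suc (upTo N)) (length-upTo N) ⟩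
  N                        ∎
  where
  open ≤-Reasoning
  open PairwiseCoprimeUpTo cop

-- Discards the diagonal term of a Cauchy-Schwarz bound when it is at most half of the left side.
absorb : ∀ {x y z} → x ≤ y + z → 2 * y ≤ x → x ≤ 2 * z
absorb {x} {y} {z} x≤y+z 2y≤x = +-cancelˡ-≤ x x (2 * z) (begin
  x + x                  ≤⟨ +-mono-≤ x≤y+z x≤y+z ⟩
  y + z + (y + z)        ≡⟨ rearrange y z ⟩
  2 * y + 2 * z          ≤⟨ +-monoˡ-≤ (2 * z) 2y≤x ⟩
  x + 2 * z              ∎)
  where
  open ≤-Reasoning
  rearrange : ∀ y z → y + z + (y + z) ≡ 2 * y + 2 * z
  rearrange = solve-∀

-- As 2K ≤ L, both diagonal terms can be absorbed, leaving L² ≤ 2Kaq and (La)² ≤ 2K³q. In the square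
-- of the first times the second, a² stands on both sides and cancels.
eliminate : ∀ L a K q → 1 ≤ a → 2 * K ≤ L →
  (L * a) * (L * a) ≤ (a * K) * (L * a + a * (a * q)) →
  (L * a) * (L * a) ≤ K * (L * a + K * (K * q)) →
  L ^ 6 ≤ 8 * (K ^ 5 * q ^ 3)
eliminate L a K q 1≤a 2K≤L h₁ h₂ = *-cancelˡ-≤ (a * a) (begin
  a * a * L ^ 6                                              ≡⟨ rearrange₁ L a ⟩
  (L * L) * (L * L) * ((L * a) * (L * a))                    ≤⟨ *-mono-≤ (*-mono-≤ small small) large ⟩
  2 * (K * (a * q)) * (2 * (K * (a * q))) * (2 * (K * (K * (K * q))))   ≡⟨ rearrange₂ a K q ⟩
  a * a * (8 * (K ^ 5 * q ^ 3))                              ∎)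
  where
  open ≤-Reasoning
  instance
    a²≢0 : NonZero (a * a)
    a²≢0 = m*n≢0 a a {{>-nonZero 1≤a}} {{>-nonZero 1≤a}}
  rearrange₁ : ∀ L a → a * a * (L * (L * (L * (L * (L * (L * 1)))))) ≡ (L * L) * (L * L) * ((L * a) * (L * a))
  rearrange₁ = solve-∀
  rearrange₂ : ∀ a K q → 2 * (K * (a * q)) * (2 * (K * (a * q))) * (2 * (K * (K * (K * q)))) ≡
                         a * a * (8 * ((K * (K * (K * (K * (K * 1))))) * (q * (q * (q * 1)))))
  rearrange₂ = solve-∀
  small : L * L ≤ 2 * (K * (a * q))
  small = absorb {y = K * L} {K * (a * q)} (*-cancelˡ-≤ (a * a) (begin
      a * a * (L * L)                    ≡⟨ left L a ⟩
      (L * a) * (L * a)                  ≤⟨ h₁ ⟩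
      (a * K) * (L * a + a * (a * q))    ≡⟨ right L a K q ⟩
      a * a * (K * L + K * (a * q))      ∎))
    (subst (_≤ L * L) (*-assoc 2 K L) (*-monoˡ-≤ L 2K≤L))
    where
    left : ∀ L a → a * a * (L * L) ≡ (L * a) * (L * a)
    left = solve-∀
    right : ∀ L a K q → (a * K) * (L * a + a * (a * q)) ≡ a * a * (K * L + K * (a * q))
    right = solve-∀
  large : (L * a) * (L * a) ≤ 2 * (K * (K * (K * q)))
  large = absorb {y = K * (L * a)} {K * (K * (K * q))} (subst ((L * a) * (L * a) ≤_) (*-distribˡ-+ K (L * a) (K * (K * q))) h₂)
    (subst (_≤ (L * a) * (L * a)) (*-assoc 2 K (L * a))
      (*-monoˡ-≤ (L * a) (≤-trans 2K≤L (m≤m*n L a {{>-nonZero 1≤a}}))))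

module _ {p : ℕ} .{{_ : NonZero p}} {N : ℕ} (1≤N : 1 ≤ N) (N⁵<p³ : N ^ 5 < p ^ 3) where

  N<p : N < p
  N<p with N <? p
  ... | yes N<p = N<p
  -- Otherwise p³ ≤ p⁵ ≤ N⁵.
  ... | no  N≮p = contradiction (≤-trans (^-monoʳ-≤ p (s≤s (s≤s (s≤s (z≤n {2}))))) (^-monoˡ-≤ 5 (≮⇒≥ N≮p))) (<⇒≱ N⁵<p³)

  -- Chosen so that intervals of length 1/b are no longer than p/N².
  b : ℕ
  b = suc (N * N / p)

  N²≤bp : N * N ≤ b * p
  N²≤bp = begin
    N * N                              ≡⟨ m≡m%n+[m/n]*n (N * N) p ⟩
    N * N % p + N * N / p * p          ≤⟨ +-monoˡ-≤ _ (m%n≤n (N * N) p) ⟩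
    b * p                              ∎
    where open ≤-Reasoning

  -- The exponent 3/5 takes quantitative effect here: for p ≤ N² one has bp ≤ 2N², so (bp)³ ≤ 8N⁶ ≤
  -- 8N p³. For larger p, b is 1.
  b³≤8N : b ^ 3 ≤ 8 * N
  b³≤8N with p ≤? N * N
  ... | no  p≰N² rewrite m<n⇒m/n≡0 (≰⇒> p≰N²) = ≤-trans 1≤N (m≤n*m N 8)
  ... | yes p≤N² = *-cancelˡ-≤ (p ^ 3) {{m^n≢0 p 3}} (begin
    p ^ 3 * b ^ 3              ≡⟨ cube p b ⟩
    (b * p) ^ 3                ≤⟨ ^-monoˡ-≤ 3 (+-mono-≤ p≤N² (m/n*n≤m (N * N) p)) ⟩
    (N * N + N * N) ^ 3        ≡⟨ sixth N ⟩
    N ^ 5 * (8 * N)            ≤⟨ *-monoˡ-≤ (8 * N) (<⇒≤ N⁵<p³) ⟩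
    p ^ 3 * (8 * N)            ∎)
    where
    open ≤-Reasoning
    cube : ∀ p b → (p * (p * (p * 1))) * (b * (b * (b * 1))) ≡ ((b * p) * ((b * p) * ((b * p) * 1)))
    cube = solve-∀
    sixth : ∀ N → ((N * N + N * N) * ((N * N + N * N) * ((N * N + N * N) * 1))) ≡ (N * (N * (N * (N * (N * 1))))) * (8 * N)
    sixth = solve-∀

  -- If L < 2K, the bound follows from L ≤ N. Otherwise `eliminate` applies with q = 2b, and 512 is
  -- 8 · 2³ · 8, the last factor from `b³≤8N`.
  |ls|⁶≤512|AA|⁵N : Prime p → ∀ {ls} → PairwiseCoprimeUpTo N ls → length ls ^ 6 ≤ 512 * (cardANAN p N ^ 5 * N)
  |ls|⁶≤512|AA|⁵N pr {ls} cop with 2 * cardANAN p N ≤? length ls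
  ... | no  2K≰L = begin
    L * L ^ 5                  ≤⟨ *-mono-≤ (length≤N cop) (^-monoˡ-≤ 5 (<⇒≤ (≰⇒> 2K≰L))) ⟩
    N * (2 * K) ^ 5            ≡⟨ rearrange K N ⟩
    32 * (K ^ 5 * N)           ≤⟨ *-monoˡ-≤ (K ^ 5 * N) (m≤m+n 32 480) ⟩
    512 * (K ^ 5 * N)          ∎
    where
    open ≤-Reasoning
    L = length ls
    K = cardANAN p N
    rearrange : ∀ K N → N * ((2 * K) * ((2 * K) * ((2 * K) * ((2 * K) * ((2 * K) * 1))))) ≡ 32 * ((K * (K * (K * (K * (K * 1))))) * N)
    rearrange = solve-∀
  ... | yes 2K≤L = begin
    L ^ 6                              ≤⟨ eliminate L (length (factResidues pr 1≤N N<p)) K (2 * b)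
                                            -- A contains the residue of N!, so |A| is at least 1.
                                            (∈-length (∈-factResidues⁺ pr 1≤N N<p 1≤N)) 2K≤L
                                            (|ls|²|A|²≤|A||AA|[|ls||A|+2B|A|²] {b} N²≤bp cop)
                                            (|ls|²|A|²≤|AA|[|ls||A|+2B|AA|²] {b} N²≤bp cop) ⟩
    8 * (K ^ 5 * (2 * b) ^ 3)          ≡⟨ rearrange K b ⟩
    64 * (K ^ 5 * b ^ 3)               ≤⟨ *-monoʳ-≤ 64 (*-monoʳ-≤ (K ^ 5) b³≤8N) ⟩
    64 * (K ^ 5 * (8 * N))             ≡⟨ rearrange′ (K ^ 5) N ⟩
    512 * (K ^ 5 * N)                  ∎
    where
    open ≤-Reasoning
    open Collisions pr 1≤N N<p
    L = length ls
    K = cardANAN p N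
    rearrange : ∀ K b → 8 * ((K * (K * (K * (K * (K * 1))))) * ((2 * b) * ((2 * b) * ((2 * b) * 1)))) ≡ 64 * ((K * (K * (K * (K * (K * 1))))) * (b * (b * (b * 1))))
    rearrange = solve-∀
    rearrange′ : ∀ K N → 64 * (K * (8 * N)) ≡ 512 * (K * N)
    rearrange′ = solve-∀

-- Extraction of roots and choice of exponents

^-cancelˡ-≤ : ∀ n .{{_ : NonZero n}} {x y} → x ^ n ≤ y ^ n → x ≤ y
^-cancelˡ-≤ n {x} {y} h with x ≤? y
... | yes x≤y = x≤y
... | no  x≰y = contradiction h (<⇒≱ (^-monoˡ-< n (≰⇒> x≰y)))

-- For t = 2(j+1), the sixth power of the density bound and the t-th power of the bound for L⁶
-- eliminate L: N^(6t) ≤ c⁶ 512^t K^(5t) N^(6+t). Since 5t = 10(j+1) and 5t - 6 ≥ 10j, tenth roots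
-- conclude. With t = j+1 the exponent 5t - 6 = 5j - 1 would fall one short of 5j.
root-bound : ∀ j {c N L K} → 1 ≤ c → 1 ≤ N →
  N ^ (2 * suc j) ≤ c * (N * L ^ (2 * suc j)) → L ^ 6 ≤ 512 * (K ^ 5 * N) →
  N ^ j ≤ (c * 512) ^ suc j * K ^ suc j
root-bound j {c} {N} {L} {K} 1≤c 1≤N dense sixth =
  ^-cancelˡ-≤ 10 (*-cancelʳ-≤ _ _ (N ^ 6 * N ^ t) (begin
    (N ^ j) ^ 10 * (N ^ 6 * N ^ t)
      ≡⟨ cong₂ _*_ (^-*-assoc N j 10) (sym (^-distribˡ-+-* N 6 t)) ⟩
    N ^ (j * 10) * N ^ (6 + t)
      ≡⟨ ^-distribˡ-+-* N (j * 10) (6 + t) ⟨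
    N ^ (j * 10 + (6 + t))
      -- The 4 is the slack in 6t = 10j + (6 + t) + 4.
      ≤⟨ ^-monoʳ-≤ N (≤-trans (m≤m+n _ 4) (≤-reflexive (exponent j))) ⟩
    N ^ (t * 6)
      ≡⟨ ^-*-assoc N t 6 ⟨
    (N ^ t) ^ 6
      ≤⟨ ^-monoˡ-≤ 6 dense ⟩
    (c * (N * L ^ t)) ^ 6
      ≡⟨ sixth-power c N (L ^ t) ⟩
    c ^ 6 * (N ^ 6 * (L ^ t) ^ 6)
      ≡⟨ cong (λ k → c ^ 6 * (N ^ 6 * k)) (^-swap L t 6) ⟩
    c ^ 6 * (N ^ 6 * (L ^ 6) ^ t)
      ≤⟨ *-monoʳ-≤ (c ^ 6) (*-monoʳ-≤ (N ^ 6) (^-monoˡ-≤ t sixth)) ⟩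
    c ^ 6 * (N ^ 6 * (512 * (K ^ 5 * N)) ^ t)
      ≡⟨ cong (λ k → c ^ 6 * (N ^ 6 * k)) (trans (^-distribʳ-* t 512 (K ^ 5 * N)) (cong (512 ^ t *_) (^-distribʳ-* t (K ^ 5) N))) ⟩
    c ^ 6 * (N ^ 6 * (512 ^ t * ((K ^ 5) ^ t * N ^ t)))
      ≡⟨ regroup (c ^ 6) (N ^ 6) (512 ^ t) ((K ^ 5) ^ t) (N ^ t) ⟩
    c ^ 6 * 512 ^ t * (K ^ 5) ^ t * (N ^ 6 * N ^ t)
      ≤⟨ *-monoˡ-≤ (N ^ 6 * N ^ t) (*-mono-≤ (*-mono-≤ c-bound 512-bound) (≤-reflexive K-power)) ⟩
    (c ^ s) ^ 10 * (512 ^ s) ^ 10 * (K ^ s) ^ 10 * (N ^ 6 * N ^ t)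
      ≡⟨ cong (_* (N ^ 6 * N ^ t)) assemble ⟩
    ((c * 512) ^ s * K ^ s) ^ 10 * (N ^ 6 * N ^ t)
      ∎))
  where
  open ≤-Reasoning
  s = suc j
  t = 2 * suc j
  instance
    N≢0 : NonZero N
    N≢0 = >-nonZero 1≤N
    c≢0 : NonZero c
    c≢0 = >-nonZero 1≤c
    N⁶N^t≢0 : NonZero (N ^ 6 * N ^ t)
    N⁶N^t≢0 = m*n≢0 (N ^ 6) (N ^ t) {{m^n≢0 N 6}} {{m^n≢0 N t}}
  exponent : ∀ j → j * 10 + (6 + 2 * suc j) + 4 ≡ 2 * suc j * 6
  exponent = solve-∀
  sixth-power : ∀ c N l → (c * (N * l)) ^ 6 ≡ c ^ 6 * (N ^ 6 * l ^ 6)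
  sixth-power c N l = trans (^-distribʳ-* 6 c (N * l)) (cong (c ^ 6 *_) (^-distribʳ-* 6 N l))
  ^-swap : ∀ x m n → (x ^ m) ^ n ≡ (x ^ n) ^ m
  ^-swap x m n = trans (^-*-assoc x m n) (trans (cong (x ^_) (*-comm m n)) (sym (^-*-assoc x n m)))
  regroup : ∀ a b d e f → a * (b * (d * (e * f))) ≡ a * d * e * (b * f)
  regroup = solve-∀
  c-bound : c ^ 6 ≤ (c ^ s) ^ 10
  c-bound = ≤-trans (^-monoʳ-≤ c (≤-trans (m≤m+n 6 4) (m≤n*m 10 s))) (≤-reflexive (sym (^-*-assoc c s 10)))
  512-bound : 512 ^ t ≤ (512 ^ s) ^ 10
  512-bound = ≤-trans (^-monoʳ-≤ 512 (≤-trans (≤-reflexive (*-comm 2 s)) (*-monoʳ-≤ s (m≤m+n 2 8))))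
                (≤-reflexive (sym (^-*-assoc 512 s 10)))
  K-power : (K ^ 5) ^ t ≡ (K ^ s) ^ 10
  K-power = trans (^-*-assoc K 5 t) (trans (cong (K ^_) (double s)) (sym (^-*-assoc K s 10)))
    where
    double : ∀ s → 5 * (2 * s) ≡ s * 10
    double = solve-∀
  assemble : (c ^ s) ^ 10 * (512 ^ s) ^ 10 * (K ^ s) ^ 10 ≡ ((c * 512) ^ s * K ^ s) ^ 10
  assemble = begin-equality
    (c ^ s) ^ 10 * (512 ^ s) ^ 10 * (K ^ s) ^ 10   ≡⟨ cong (_* (K ^ s) ^ 10) (^-distribʳ-* 10 (c ^ s) (512 ^ s)) ⟨
    (c ^ s * 512 ^ s) ^ 10 * (K ^ s) ^ 10          ≡⟨ ^-distribʳ-* 10 (c ^ s * 512 ^ s) (K ^ s) ⟨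
    (c ^ s * 512 ^ s * K ^ s) ^ 10                 ≡⟨ cong (λ k → (k * K ^ s) ^ 10) (^-distribʳ-* s c 512) ⟨
    ((c * 512) ^ s * K ^ s) ^ 10                   ∎

-- Real exponents are avoided by taking ε = 1/(j+1): the conclusion is the (j+1)-th power of N^(1-ε)
-- ≤ C |AA|, so c(ε) is 1/C, and a general ε is served by any j with 1/(j+1) ≤ ε. Likewise N <
-- p^(3/5) is written `N ^ 5 < p ^ 3`.
theorem4 : (j : ℕ) → Σ ℕ λ C → Σ ℕ λ p₀ → 1 ≤ C ×
    ((p : ℕ) → .{{_ : NonZero p}} → Prime p → p₀ ≤ p →
    (N : ℕ) → 1 ≤ N → N ^ 5 < p ^ 3 →
    N ^ j ≤ (C ^ suc j) * (cardANAN p N ^ suc j))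
theorem4 j = c * 512 , 0 , *-mono-≤ 1≤c (s≤s z≤n) , λ p pr _ N 1≤N N⁵<p³ →
  root-bound j {K = cardANAN p N} 1≤c 1≤N (labels-dense t N 1≤N) (|ls|⁶≤512|AA|⁵N 1≤N N⁵<p³ pr (labels-pairwiseCoprime 1≤N))
  where
  t = 2 * suc j
  c = 2 ^ t * t ^ t * 4
  1≤c : 1 ≤ c
  1≤c = *-mono-≤ (*-mono-≤ (m^n>0 2 t) (m^n>0 t t)) (s≤s {n = 3} z≤n)
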